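{- Let $d\ge2$ and let $i,j$ be nonnegative integers with $j<d-1$ such that either $(i,j)=(0,0)$, or $i\ge1$ and $i+j\le d-1$. Define $$f_d(i,j,x)=\sum_{k=0}^{d-1} C_{d-1-k}(1-x)^kx^{d-k}\sum_{s=0}^{j}\binom{j}{s}\binom{d+i+j-1-k-s}{k-s},\qquad C_n=\tfrac1{n+1}\tbinom{2n}{n}.$$ Then for every $m$, the coefficient of $x^{d-m}$ in $f_d(i,j,x)$ equals the number of plane trees on $d$ vertices (with vertices labeled $1,\ldots,d$ in postorder) having exactly $m$ vertices $v$ with one of the following properties: $v$ is a type $(0)$ special vertex; $v$ is a type $(1)$ special vertex whose postorder label is at most $i$ or at least $d-j$; $v$ is a type $(2)$ special vertex whose postorder label is at least $d-j$.
   Context: A plane tree is a rooted tree in which the children of each vertex are linearly ordered (left to right); the first child in this order is the leftmost child. A leaf is a vertex with no children. Postorder labeling of a plane tree on $n$ vertices: remove the root, label the vertices of the subtrees rooted at the root's children, taken left to right, consecutively, each subtree recursively in postorder; finally give the root label $n$. Special vertices: $v$ is type $(0)$ if $v$ is a leaf, is the leftmost child of its parent, and its parent is not the root; $v$ is type $(1)$ if $v$ is a leaf and either $v$ is the leftmost child of the root or $v$ is not the leftmost child of its parent; $v$ is type $(2)$ if $v$ is not a leaf and is the leftmost child of its parent. (The polynomial $f_d(i,j,x)$ is the change in Stanley's toric $f$-polynomial of the face poset caused by adding a facet of type $(i,j)$ in a shelling of a $(d-1)$-dimensional cubical complex; the hypotheses on $(i,j)$ describe the possible types with $j<d-1$.)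 -}

module Defs where

open import Data.Bool using (Bool; true; false; _∧_; _∨_; not; if_then_else_)
open import Data.Nat as ℕ using (ℕ; zero; suc; _∸_; _≤ᵇ_)
open import Data.Nat.Combinatorics using (_C_)
open import Data.Nat.DivMod using (_/_)
open import Data.Integer as ℤ using (ℤ; +_; -[1+_])
open import Data.List using (List; []; _∷_; _++_; [_]; replicate; map; length; filter)
open import Data.Product using (_×_)

data Tree : Set where
  node : List Tree → Tree

mutual
  size : Tree → ℕ
  size (node ts) = suc (sizes ts)

  sizes : List Tree → ℕ
  sizes []       = 0
  sizes (t ∷ ts) = size t ℕ.+ sizes ts

isNil : {A : Set} → List A → Bool
isNil []      = true
isNil (_ ∷ _) = false

record VInfo : Set where
  constructor vinfo
  field
    isLeaf     : Bool
    isLeftmost : Bool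
    parentRoot : Bool
    label      : ℕ      -- postorder label of v (labels are 1..n)
open VInfo public

-- verts pr lm o t : info for all vertices of the subtree t (t is a non-root
-- vertex; pr = its parent is the root, lm = it is the leftmost child,
-- o = number of vertices labelled before the subtree t in postorder).
mutual
  verts : Bool → Bool → ℕ → Tree → List VInfo
  verts pr lm o (node ts) =
    kids false true o ts ++ [ vinfo (isNil ts) lm pr (o ℕ.+ size (node ts)) ]

  kids : Bool → Bool → ℕ → List Tree → List VInfo
  kids pr lm o []       = []
  kids pr lm o (t ∷ ts) = verts pr lm o t ++ kids pr false (o ℕ.+ size t) ts

-- all non-root vertices of a tree (the root gets label n = size and is
-- never special, since it has no parent)
nonRootVertices : Tree → List VInfo
nonRootVertices (node ts) = kids true true 0 ts

type0 : VInfo → Bool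
type0 v = isLeaf v ∧ isLeftmost v ∧ not (parentRoot v)

type1 : VInfo → Bool
type1 v = isLeaf v ∧ ((isLeftmost v ∧ parentRoot v) ∨ not (isLeftmost v))

type2 : VInfo → Bool
type2 v = not (isLeaf v) ∧ isLeftmost v

counted : (n i j : ℕ) → VInfo → Bool
counted n i j v =
  type0 v
  ∨ (type1 v ∧ ((label v ≤ᵇ i) ∨ ((n ∸ j) ≤ᵇ label v)))
  ∨ (type2 v ∧ ((n ∸ j) ≤ᵇ label v))

countSpecial : (i j : ℕ) → Tree → ℕ
countSpecial i j t = length (filter (λ v → counted (size t) i j v Data.Bool.≟ true) (nonRootVertices t))
  where import Data.Bool

-- Polynomials over ℤ as coefficient lists (constant term first).

Poly : Set
Poly = List ℤ

padd : Poly → Poly → Poly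
padd []       q        = q
padd (a ∷ p)  []       = a ∷ p
padd (a ∷ p)  (b ∷ q)  = (a ℤ.+ b) ∷ padd p q

pscale : ℤ → Poly → Poly
pscale c p = map (c ℤ.*_) p

pmul : Poly → Poly → Poly
pmul []      q = []
pmul (a ∷ p) q = padd (pscale a q) (+ 0 ∷ pmul p q)

pone : Poly
pone = + 1 ∷ []

ppow : Poly → ℕ → Poly
ppow p zero    = pone
ppow p (suc k) = pmul p (ppow p k)

xpow : ℕ → Poly
xpow n = replicate n (+ 0) ++ pone

oneMinusX : Poly
oneMinusX = + 1 ∷ -[1+ 0 ] ∷ []

coeff : Poly → ℕ → ℤ
coeff []      n       = + 0
coeff (a ∷ p) zero    = a
coeff (a ∷ p) (suc n) = coeff p n

sumℕ : ℕ → (ℕ → ℕ) → ℕ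
sumℕ zero    f = 0
sumℕ (suc n) f = sumℕ n f ℕ.+ f n

sumPoly : ℕ → (ℕ → Poly) → Poly
sumPoly zero    f = []
sumPoly (suc n) f = padd (sumPoly n f) (f n)

catalan : ℕ → ℕ
catalan n = ((2 ℕ.* n) C n) / suc n

-- binom(j,s) * binom(d+i+j-1-k-s, k-s), with binom(., k-s) = 0 when s > k
innerTerm : (d i j k s : ℕ) → ℕ
innerTerm d i j k s =
  if (s ≤ᵇ k) then (j C s) ℕ.* (((d ℕ.+ i ℕ.+ j) ∸ (1 ℕ.+ k ℕ.+ s)) C (k ∸ s)) else 0

innerSum : (d i j k : ℕ) → ℕ
innerSum d i j k = sumℕ (suc j) (innerTerm d i j k)

fPoly : (d i j : ℕ) → Poly
fPoly d i j = sumPoly d (λ k →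
  pscale (+ (catalan (d ∸ 1 ∸ k) ℕ.* innerSum d i j k))
         (pmul (ppow oneMinusX k) (xpow (d ∸ k))))

{-# OPTIONS --safe #-}
-- Put y = 1/x and z = y − 1.  Then f_d(i, j, x) = x^d Σ_k z^k C_{d−1−k} a_k, where a_k is the inner
-- sum, so the claim is that Σ_T y^(number of counted vertices of T) = Σ_k z^k C_{d−1−k} a_k.
--
-- Let i ≥ 1.  Read the forest below the root as a binary tree: the right subtree of a vertex holds its
-- children and the left subtree its earlier siblings.  Postorder becomes binary postorder, and a vertex
-- weighs y without subtrees, y or 1 (depending on its label) with one subtree, and 1 with two.  Peeling
-- off the last vertices of a stack of binary trees turns the weighted count into one of Motzkin paths
-- with up-steps y, down-steps 1 and level steps 2 + δ z, with δ = 1 for labels ≤ i, δ = 2 for labels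
-- ≥ d − j and δ = 0 otherwise.  As level steps can be deleted anywhere, both sides,
-- as polynomials F_d(i, j) in z, obey F_d(i, j) = F_d(i−1, j) + z F_{d−1}(i−1, j) for i ≥ 2 and
-- F_d(i, j) = F_d(i, j−1) + 2 z F_{d−1}(i, j−1) for j ≥ 1, which leaves the case where δ = 0
-- throughout, settled by a closed form for all final heights.
--
-- For i = j = 0 only leftmost leaves off the root count.  They differ from all leftmost leaves only in
-- forests whose first tree is a single vertex, so F_d(0, 0) follows from F_d(1, 0) by induction on d.
module Submission where

open import Defs
open import Data.Nat using (ℕ; _≤_; _<_; _+_; _∸_)
open import Data.Integer using (+_)
open import Data.Fin using (Fin)
open import Data.Product using (Σ; ∃-syntax; _×_)
open import Data.Sum using (_⊎_)
open import Function.Bundles using (_↔_)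
open import Relation.Binary.PropositionalEquality using (_≡_)

open import Algebra.Properties.CommutativeSemigroup using () renaming (interchange to medial)
open import Axiom.UniquenessOfIdentityProofs using (module Decidable⇒UIP)
open import Data.Bool as Bool using (Bool; true; false; _∧_; _∨_; not; if_then_else_)
import Data.Bool.Properties as Bool
open import Data.Empty using (⊥-elim)
open import Data.Fin using (zero; suc)
open import Data.Fin.Permutation using (↔⇒≡)
open import Data.Fin.Properties using (+↔⊎)
open import Data.Integer as ℤ using (ℤ; -[1+_])
import Data.Integer.Properties as ℤ
import Data.Integer.Tactic.RingSolver as ℤ-Solver
open import Data.List using (List; []; _∷_; _++_; replicate; length; filter; [_])
open import Data.List.Properties using (length-replicate; ++-identityʳ; ++-assoc)
open import Data.Maybe using (Maybe; just; nothing; maybe′)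
open import Data.Nat using (zero; suc; _*_; _≤ᵇ_; _<ᵇ_; z≤n; s≤s)
open import Data.Nat.Combinatorics using (_C_; nCk+nC[k+1]≡[n+1]C[k+1]; k>n⇒nCk≡0)
open import Data.Nat.DivMod using (_/_; m*n/n≡m)
open import Data.Nat.Properties
import Data.Nat.Tactic.RingSolver as ℕ-Solver
open import Data.Product using (_,_; proj₁; proj₂)
open import Data.Sum as Sum using (inj₁; inj₂)
open import Data.Sum.Algebra using (⊎-comm)
open import Data.Sum.Function.Propositional using (_⊎-↔_)
open import Data.Sum.Properties using (inj₁-injective)
open import Data.Unit using (tt)
open import Function using (_∘_)
open import Function.Bundles using (mk↔ₛ′; Inverse)
open import Function.Properties.Inverse using (↔-sym; ↔-trans)
open import Relation.Binary.PropositionalEquality using (refl; sym; trans; cong; cong₂; subst; module ≡-Reasoning)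
open import Relation.Nullary using (¬_; Irrelevant)

-- Binomial sums

-- A structural recursion, so that Pascal's rule holds by computation.
binom : ℕ → ℕ → ℕ
binom n       zero    = 1
binom zero    (suc k) = 0
binom (suc n) (suc k) = binom n k + binom n (suc k)

C≡binom : ∀ n k → n C k ≡ binom n k
C≡binom n       zero    = refl
C≡binom zero    (suc k) = k>n⇒nCk≡0 (s≤s (z≤n {k}))
C≡binom (suc n) (suc k) = trans (sym (nCk+nC[k+1]≡[n+1]C[k+1] n k)) (cong₂ _+_ (C≡binom n k) (C≡binom n (suc k)))

binom-zero : ∀ {n k} → n < k → binom n k ≡ 0
binom-zero {zero}  {suc k} _         = refl
binom-zero {suc n} {suc k} (s≤s n<k) = cong₂ _+_ (binom-zero n<k) (binom-zero (m<n⇒m<1+n n<k))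

binom-diag : ∀ n → binom n n ≡ 1
binom-diag zero    = refl
binom-diag (suc n) = cong₂ _+_ (binom-diag n) (binom-zero (n<1+n n))

-- This is (k + 1) C(n, k + 1) = (n - k) C(n, k) with the subtraction moved across, which makes it
-- true for k > n as well. Row n + 1 follows from row n at k and at k + 1.
binom-shift : ∀ n k → suc k * binom n (suc k) + k * binom n k ≡ n * binom n k
binom-shift zero    zero    = refl
binom-shift zero    (suc k) = cong₂ _+_ (*-zeroʳ k) (*-zeroʳ k)
binom-shift (suc n) zero    = trans (cong (λ x → 1 * (1 + x) + 0) (binom1 n)) (ℕ-Solver.solve (n Data.List.∷ Data.List.[]))
  where
  import Data.List
  binom1 : ∀ n → binom n 1 ≡ n
  binom1 zero    = refl
  binom1 (suc n) = cong suc (binom1 n)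
binom-shift (suc n) (suc k) =
  trans (regroup k (binom n k) (binom n (suc k)) (binom n (suc (suc k))))
 (trans (cong₂ (λ x y → x + y + binom n (suc k) + binom n k) (binom-shift n (suc k)) (binom-shift n k))
        (collect n (binom n k) (binom n (suc k))))
  where
  regroup : ∀ k a b c → suc (suc k) * (b + c) + suc k * (a + b)
          ≡ (suc (suc k) * c + suc k * b) + (suc k * b + k * a) + b + a
  regroup = ℕ-Solver.solve-∀
  collect : ∀ n a b → n * b + n * a + b + a ≡ suc n * (a + b)
  collect = ℕ-Solver.solve-∀

-- The coefficients of z · Σ_k f k z^k.
shift : (ℕ → ℕ) → ℕ → ℕ
shift f zero    = 0
shift f (suc k) = f k

-- The value at 0 of (1 + E)^j f, where E replaces f by `f ∘ suc`; expanding the power gives the sum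
-- in `sumℕ-binom`.
binomialSum : ℕ → (ℕ → ℕ) → ℕ
binomialSum zero    f = f 0
binomialSum (suc j) f = binomialSum j f + binomialSum j (f ∘ suc)

binomialSum-zero : ∀ j → binomialSum j (λ _ → 0) ≡ 0
binomialSum-zero zero    = refl
binomialSum-zero (suc j) = cong₂ _+_ (binomialSum-zero j) (binomialSum-zero j)

sumℕ-cong : ∀ n {f g : ℕ → ℕ} → (∀ s → s < n → f s ≡ g s) → sumℕ n f ≡ sumℕ n g
sumℕ-cong zero    f≗g = refl
sumℕ-cong (suc n) f≗g = cong₂ _+_ (sumℕ-cong n (λ s s<n → f≗g s (m<n⇒m<1+n s<n))) (f≗g n (n<1+n n))

sumℕ-first : ∀ n f → sumℕ (suc n) f ≡ f 0 + sumℕ n (f ∘ suc)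
sumℕ-first zero    f = +-comm 0 (f 0)
sumℕ-first (suc n) f = trans (cong (_+ f (suc n)) (sumℕ-first n f)) (+-assoc (f 0) _ _)

sumℕ-+ : ∀ n f g → sumℕ n (λ s → f s + g s) ≡ sumℕ n f + sumℕ n g
sumℕ-+ zero    f g = refl
sumℕ-+ (suc n) f g = trans (cong (_+ (f n + g n)) (sumℕ-+ n f g)) (medial +-commutativeSemigroup (sumℕ n f) (sumℕ n g) (f n) (g n))

sumℕ-binom : ∀ j f → sumℕ (suc j) (λ s → binom j s * f s) ≡ binomialSum j f
sumℕ-binom zero    f = +-identityʳ (f 0)
sumℕ-binom (suc j) f = begin
  sumℕ (suc (suc j)) (λ s → binom (suc j) s * f s)
    ≡⟨ sumℕ-first (suc j) (λ s → binom (suc j) s * f s) ⟩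
  1 * f 0 + sumℕ (suc j) (λ s → (binom j s + binom j (suc s)) * f (suc s))
    ≡⟨ cong (λ w → 1 * f 0 + w) (sumℕ-cong (suc j) (λ s _ → *-distribʳ-+ (f (suc s)) (binom j s) (binom j (suc s)))) ⟩
  1 * f 0 + sumℕ (suc j) (λ s → binom j s * f (suc s) + binom j (suc s) * f (suc s))
    ≡⟨ cong (λ w → 1 * f 0 + w) (sumℕ-+ (suc j) _ _) ⟩
  1 * f 0 + (sumℕ (suc j) (λ s → binom j s * f (suc s)) + sumℕ (suc j) (λ s → binom j (suc s) * f (suc s)))
    ≡⟨ rotate (1 * f 0) _ _ ⟩
  (1 * f 0 + sumℕ (suc j) (λ s → binom j (suc s) * f (suc s))) + sumℕ (suc j) (λ s → binom j s * f (suc s))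
    ≡⟨ cong₂ _+_ (sym (sumℕ-first (suc j) (λ s → binom j s * f s))) (sumℕ-binom j (f ∘ suc)) ⟩
  sumℕ (suc j) (λ s → binom j s * f s) + binom j (suc j) * f (suc j) + binomialSum j (f ∘ suc)
    ≡⟨ cong (λ x → sumℕ (suc j) (λ s → binom j s * f s) + x * f (suc j) + binomialSum j (f ∘ suc)) (binom-zero (n<1+n j)) ⟩
  sumℕ (suc j) (λ s → binom j s * f s) + 0 + binomialSum j (f ∘ suc)
    ≡⟨ cong (_+ binomialSum j (f ∘ suc)) (trans (+-identityʳ _) (sumℕ-binom j f)) ⟩
  binomialSum j f + binomialSum j (f ∘ suc) ∎
  where
  open ≡-Reasoning
  rotate : ∀ a b c → a + (b + c) ≡ (a + c) + b
  rotate = ℕ-Solver.solve-∀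

-- binom (n ∸ s) (k ∸ s), set to 0 when s > k.
diagBinom : ℕ → ℕ → ℕ → ℕ
diagBinom n       k       zero    = binom n k
diagBinom n       zero    (suc s) = 0
diagBinom zero    (suc k) (suc s) = binom 0 (k ∸ s)
diagBinom (suc n) (suc k) (suc s) = diagBinom n k s

-- As k < d, the upper index d + i + j - 1 - k is at least j, so subtracting s ≤ j from it never
-- truncates.
innerSum≡ : ∀ d i j k → k < d → innerSum d i j k ≡ binomialSum j (diagBinom (d + i + j ∸ suc k) k)
innerSum≡ d i j k k<d = trans (sumℕ-cong (suc j) (λ s s≤j → term s (≤-pred s≤j))) (sumℕ-binom j _)
  where
  -- `_<ᵇ_` reduces on two successors, so `diag` can lower `s` and `k` together.
  ≤ᵇ⇔<ᵇsuc : ∀ s k → (s ≤ᵇ k) ≡ (s <ᵇ suc k)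
  ≤ᵇ⇔<ᵇsuc zero    k = refl
  ≤ᵇ⇔<ᵇsuc (suc s) k = refl
  diag : ∀ c s k n → s ≤ n → (if s <ᵇ suc k then c * ((n ∸ s) C (k ∸ s)) else 0) ≡ c * diagBinom n k s
  diag c zero    k       n       _         = cong (c *_) (C≡binom n k)
  diag c (suc s) zero    n       _         = sym (*-zeroʳ c)
  diag c (suc s) (suc k) (suc n) (s≤s s≤n) = diag c s k n s≤n
  bound : ∀ {s} → s ≤ j → s ≤ d + i + j ∸ suc k
  bound {s} s≤j = ≤-trans s≤j (≤-trans (m≤n+m j (d ∸ suc k + i)) (≤-reflexive eq))
    where
    eq : d ∸ suc k + i + j ≡ d + i + j ∸ suc k
    eq = trans (cong (_+ j) (sym (+-∸-comm i k<d))) (sym (+-∸-comm j (≤-trans k<d (m≤m+n d i))))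
  term : ∀ s → s ≤ j → innerTerm d i j k s ≡ binom j s * diagBinom (d + i + j ∸ suc k) k s
  term s s≤j = trans
    (cong₂ (λ b n → if b then (j C s) * (n C (k ∸ s)) else 0) (≤ᵇ⇔<ᵇsuc s k) (sym (∸-+-assoc (d + i + j) (suc k) s)))
    (trans (diag (j C s) s k _ (bound s≤j)) (cong (_* diagBinom (d + i + j ∸ suc k) k s) (C≡binom j s)))

-- For j ≤ n, `binomialSum j (diagBinom n k)` is the coefficient of z^k in Σ_s C(j, s) z^s (1 +
-- z)^(n - s) = (1 + z)^(n - j) (1 + 2 z)^j. Raising n multiplies this by 1 + z.
binomialSum-pascal : ∀ j n k → j ≤ n →
  binomialSum j (diagBinom (suc n) k) ≡ binomialSum j (diagBinom n k) + shift (λ k → binomialSum j (diagBinom n k)) k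
binomialSum-pascal zero    n       zero    _ = refl
binomialSum-pascal zero    n       (suc k) _ = +-comm (binom n k) (binom n (suc k))
binomialSum-pascal (suc j) (suc n) zero    (s≤s j≤n) =
  trans (cong (_+ binomialSum j (λ _ → 0)) (binomialSum-pascal j (suc n) zero (m≤n⇒m≤1+n j≤n))) (swap (binomialSum j (diagBinom (suc n) 0)) _)
  where
  swap : ∀ a b → a + 0 + b ≡ a + b + 0
  swap = ℕ-Solver.solve-∀
binomialSum-pascal (suc j) (suc n) (suc zero) (s≤s j≤n) = begin
  B (suc (suc n)) 1 + B (suc n) 0
    ≡⟨ cong₂ _+_ (binomialSum-pascal j (suc n) 1 (m≤n⇒m≤1+n j≤n)) (binomialSum-pascal j n 0 j≤n) ⟩
  B (suc n) 1 + B (suc n) 0 + (B n 0 + 0)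
    ≡⟨ medial +-commutativeSemigroup (B (suc n) 1) (B (suc n) 0) (B n 0) 0 ⟩
  B (suc n) 1 + B n 0 + (B (suc n) 0 + 0)
    ≡⟨ cong (λ z → B (suc n) 1 + B n 0 + (B (suc n) 0 + z)) (sym (binomialSum-zero j)) ⟩
  B (suc n) 1 + B n 0 + (B (suc n) 0 + binomialSum j (λ _ → 0)) ∎
  where
  open ≡-Reasoning
  B : ℕ → ℕ → ℕ
  B n k = binomialSum j (diagBinom n k)
binomialSum-pascal (suc j) (suc n) (suc (suc k)) (s≤s j≤n) =
  trans (cong₂ _+_ (binomialSum-pascal j (suc n) (suc (suc k)) (m≤n⇒m≤1+n j≤n)) (binomialSum-pascal j n (suc k) j≤n))
        (medial +-commutativeSemigroup (B (suc n) (suc (suc k))) (B (suc n) (suc k)) (B n (suc k)) (B n k))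
  where
  B : ℕ → ℕ → ℕ
  B n k = binomialSum j (diagBinom n k)

-- Raising both j and n multiplies (1 + z)^(n - j) (1 + 2 z)^j by 1 + 2 z.
binomialSum-suc : ∀ j n k → j ≤ n →
  binomialSum (suc j) (diagBinom (suc n) k) ≡ binomialSum j (diagBinom n k) + 2 * shift (λ k → binomialSum j (diagBinom n k)) k
binomialSum-suc j n zero    j≤n =
  trans (cong₂ _+_ (binomialSum-pascal j n zero j≤n) (binomialSum-zero j)) (+-identityʳ _)
binomialSum-suc j n (suc k) j≤n =
  trans (cong (_+ binomialSum j (diagBinom n k)) (binomialSum-pascal j n (suc k) j≤n))
        (double (binomialSum j (diagBinom n (suc k))) (binomialSum j (diagBinom n k)))
  where
  double : ∀ a b → a + b + b ≡ a + 2 * b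
  double = ℕ-Solver.solve-∀

-- suc n * binom (2 n) (suc n) = n * binom (2 n) n makes the central binomial coefficient a multiple of suc n.
catalan-spec : ∀ n → catalan n * suc n ≡ binom (2 * n) n
catalan-spec n = trans (cong (_* suc n) quotient) product
  where
  open ≡-Reasoning
  b b′ : ℕ
  b  = binom (2 * n) n
  b′ = binom (2 * n) (suc n)
  upper : suc n * b′ ≡ n * b
  upper = +-cancelʳ-≡ (n * b) _ _ (trans (binom-shift (2 * n) n) (two n b))
    where
    two : ∀ n b → 2 * n * b ≡ n * b + n * b
    two = ℕ-Solver.solve-∀
  product : (b ∸ b′) * suc n ≡ b
  product = begin
    (b ∸ b′) * suc n          ≡⟨ *-distribʳ-∸ (suc n) b b′ ⟩
    b * suc n ∸ b′ * suc n    ≡⟨ cong₂ _∸_ (*-comm b (suc n)) (trans (*-comm b′ (suc n)) upper) ⟩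
    b + n * b ∸ n * b         ≡⟨ m+n∸n≡m b (n * b) ⟩
    b                         ∎
  quotient : catalan n ≡ b ∸ b′
  quotient = trans (cong (_/ suc n) (trans (C≡binom (2 * n) n) (sym product))) (m*n/n≡m (b ∸ b′) (suc n))

-- Weighted Motzkin paths

-- motzkin δs h k is the coefficient of z^k in the weight of the Motzkin paths from height 0 to
-- height h that stay positive after the first step; up-steps weigh 1 + z, down-steps 1, and the
-- level steps 2 + δ z, where δs lists the δ's from the last step to the first.
motzkin : List ℕ → ℕ → ℕ → ℕ
motzkin []       zero    zero    = 1
motzkin []       zero    (suc k) = 0
motzkin []       (suc h) k       = 0
motzkin (δ ∷ δs) zero    k       = 0
motzkin (δ ∷ δs) (suc h) k       =
  motzkin δs h k + shift (motzkin δs h) k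
  + (2 * motzkin δs (suc h) k + δ * shift (motzkin δs (suc h)) k)
  + motzkin δs (suc (suc h)) k

shift-zero : ∀ {f : ℕ → ℕ} → (∀ k → f k ≡ 0) → ∀ k → shift f k ≡ 0
shift-zero f≗0 zero    = refl
shift-zero f≗0 (suc k) = f≗0 k

shift-cong : ∀ {f g : ℕ → ℕ} → (∀ k → f k ≡ g k) → ∀ k → shift f k ≡ shift g k
shift-cong f≗g zero    = refl
shift-cong f≗g (suc k) = f≗g k

shift-+shift : ∀ {f g p : ℕ → ℕ} → (∀ k → f k ≡ g k + shift p k) → ∀ k → shift f k ≡ shift g k + shift (shift p) k
shift-+shift f≗ zero    = refl
shift-+shift f≗ (suc k) = f≗ k

shift-motzkin : ∀ δ δs h k → shift (motzkin (δ ∷ δs) (suc h)) k ≡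
  shift (motzkin δs h) k + shift (shift (motzkin δs h)) k
  + (2 * shift (motzkin δs (suc h)) k + δ * shift (shift (motzkin δs (suc h))) k)
  + shift (motzkin δs (suc (suc h))) k
shift-motzkin δ δs h zero    = sym (trans (+-identityʳ (δ * 0)) (*-zeroʳ δ))
shift-motzkin δ δs h (suc k) = refl

motzkin-congˡ : ∀ δs {γs γs′} → (∀ h k → motzkin γs h k ≡ motzkin γs′ h k) →
  ∀ h k → motzkin (δs ++ γs) h k ≡ motzkin (δs ++ γs′) h k
motzkin-congˡ []       γs≗ h       k = γs≗ h k
motzkin-congˡ (δ ∷ δs) γs≗ zero    k = refl
motzkin-congˡ (δ ∷ δs) γs≗ (suc h) k =
  cong₂ _+_
    (cong₂ _+_ (cong₂ _+_ (ih h k) (shift-cong (ih h) k))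
               (cong₂ (λ x y → 2 * x + δ * y) (ih (suc h) k) (shift-cong (ih (suc h)) k)))
    (ih (suc (suc h)) k)
  where ih = motzkin-congˡ δs γs≗

-- The last summand of the level weight 2 + (suc δ) z = (2 + δ z) + z amounts to deleting the step.
motzkin-delete : ∀ δs δ γs → (∀ k → motzkin γs 0 k ≡ 0) → ∀ h k →
  motzkin (δs ++ suc δ ∷ γs) h k ≡ motzkin (δs ++ δ ∷ γs) h k + shift (motzkin (δs ++ γs) h) k
-- At height 0 both terms that contain the step vanish, so the path without it must vanish too. This
-- fails if the step is the only one, whence the hypothesis on `γs`.
motzkin-delete []       δ γs γs≗0 zero    k = sym (shift-zero γs≗0 k)
motzkin-delete []       δ γs γs≗0 (suc h) k =
  split δ (motzkin γs h k + shift (motzkin γs h) k) (motzkin γs (suc h) k) (shift (motzkin γs (suc h)) k) (motzkin γs (suc (suc h)) k)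
  where
  split : ∀ δ a b c d → a + (2 * b + (c + δ * c)) + d ≡ a + (2 * b + δ * c) + d + c
  split = ℕ-Solver.solve-∀
motzkin-delete (ε ∷ δs) δ γs γs≗0 zero    k = sym (shift-zero (λ _ → refl) k)
motzkin-delete (ε ∷ δs) δ γs γs≗0 (suc h) k = begin
  motzkin (ε ∷ δs ++ suc δ ∷ γs) (suc h) k
    ≡⟨ cong₂ _+_
         (cong₂ _+_ (cong₂ _+_ (ih h k) (shift-+shift (ih h) k))
                    (cong₂ (λ x y → 2 * x + ε * y) (ih (suc h) k) (shift-+shift (ih (suc h)) k)))
         (ih (suc (suc h)) k) ⟩
  A h + S h + (SA h + SS h) + (2 * (A (suc h) + S (suc h)) + ε * (SA (suc h) + SS (suc h))) + (A (suc (suc h)) + S (suc (suc h)))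
    ≡⟨ separate ε (A h) (S h) (SA h) (SS h) (A (suc h)) (S (suc h)) (SA (suc h)) (SS (suc h)) (A (suc (suc h))) (S (suc (suc h))) ⟩
  motzkin (ε ∷ δs ++ δ ∷ γs) (suc h) k + (S h + SS h + (2 * S (suc h) + ε * SS (suc h)) + S (suc (suc h)))
    ≡⟨ cong (λ w → motzkin (ε ∷ δs ++ δ ∷ γs) (suc h) k + w) (sym (shift-motzkin ε (δs ++ γs) h k)) ⟩
  motzkin (ε ∷ δs ++ δ ∷ γs) (suc h) k + shift (motzkin (ε ∷ δs ++ γs) (suc h)) k ∎
  where
  open ≡-Reasoning
  ih = motzkin-delete δs δ γs γs≗0
  A SA S SS : ℕ → ℕ
  A  h = motzkin (δs ++ δ ∷ γs) h k
  SA h = shift (motzkin (δs ++ δ ∷ γs) h) k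
  S  h = shift (motzkin (δs ++ γs) h) k
  SS h = shift (shift (motzkin (δs ++ γs) h)) k
  separate : ∀ ε a s b t a′ s′ b′ t′ a″ s″ →
    a + s + (b + t) + (2 * (a′ + s′) + ε * (b′ + t′)) + (a″ + s″)
    ≡ (a + b + (2 * a′ + ε * b′) + a″) + (s + t + (2 * s′ + ε * t′) + s″)
  separate = ℕ-Solver.solve-∀

motzkin-high : ∀ δs h k → length δs < h → motzkin δs h k ≡ 0
motzkin-high []       (suc h) k _ = refl
motzkin-high (δ ∷ δs) (suc h) k (s≤s n<h)
  rewrite motzkin-high δs h k n<h
        | shift-zero (λ k → motzkin-high δs h k n<h) k
        | motzkin-high δs (suc h) k (m<n⇒m<1+n n<h)
        | shift-zero (λ k → motzkin-high δs (suc h) k (m<n⇒m<1+n n<h)) k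
        | motzkin-high δs (suc (suc h)) k (m<n⇒m<1+n (m<n⇒m<1+n n<h))
        | *-zeroʳ δ = refl

motzkin-degree : ∀ δs h k → length δs < k → motzkin δs h k ≡ 0
motzkin-degree []       zero    (suc k) _ = refl
motzkin-degree []       (suc h) k       _ = refl
motzkin-degree (δ ∷ δs) zero    k       _ = refl
motzkin-degree (δ ∷ δs) (suc h) (suc k) (s≤s n<k)
  rewrite motzkin-degree δs h (suc k) (m<n⇒m<1+n n<k)
        | motzkin-degree δs h k n<k
        | motzkin-degree δs (suc h) (suc k) (m<n⇒m<1+n n<k)
        | motzkin-degree δs (suc h) k n<k
        | motzkin-degree δs (suc (suc h)) (suc k) (m<n⇒m<1+n n<k)
        | *-zeroʳ δ = refl

-- The closed form when every δ is 0

binom-absorb : ∀ n k → suc k * binom (suc n) (suc k) ≡ suc n * binom n k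
binom-absorb n k = trans (expand k (binom n k) (binom n (suc k))) (cong (λ w → binom n k + w) (binom-shift n k))
  where
  expand : ∀ k a b → suc k * (a + b) ≡ a + (suc k * b + k * a)
  expand = ℕ-Solver.solve-∀

binom-below : ∀ k m → suc k * binom (k + m) (suc k) ≡ m * binom (k + m) k
binom-below k m = +-cancelʳ-≡ (k * binom (k + m) k) _ _
  (trans (binom-shift (k + m) k) (split k m (binom (k + m) k)))
  where
  split : ∀ k m b → (k + m) * b ≡ m * b + k * b
  split = ℕ-Solver.solve-∀

binom-suc : ∀ n k → binom (suc n) k ≡ binom n k + shift (binom n) k
binom-suc n zero    = refl
binom-suc n (suc k) = +-comm (binom n k) (binom n (suc k))

binom-suc² : ∀ n k → binom (suc (suc n)) k ≡ binom n k + 2 * shift (binom n) k + shift (shift (binom n)) k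
binom-suc² n zero    = refl
binom-suc² n (suc k) = trans (cong (_+ (binom n k + binom n (suc k))) (binom-suc n k)) (reorder (binom n k) (shift (binom n) k) (binom n (suc k)))
  where
  reorder : ∀ a b c → a + b + (a + c) ≡ c + 2 * a + b
  reorder = ℕ-Solver.solve-∀

-- Absorption k C(n + 2, k) = (n + 2) C(n + 1, k - 1), with both sides expanded in row n.
binom-absorb² : ∀ n k → k * (binom n k + 2 * shift (binom n) k + shift (shift (binom n)) k)
              ≡ suc (suc n) * (shift (binom n) k + shift (shift (binom n)) k)
binom-absorb² n zero    = sym (*-zeroʳ n)
binom-absorb² n (suc k) = begin
  suc k * (binom n (suc k) + 2 * binom n k + shift (binom n) k) ≡⟨ cong (suc k *_) (sym (binom-suc² n (suc k))) ⟩
  suc k * binom (suc (suc n)) (suc k)                           ≡⟨ binom-absorb (suc n) k ⟩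
  suc (suc n) * binom (suc n) k                                 ≡⟨ cong (suc (suc n) *_) (binom-suc n k) ⟩
  suc (suc n) * (binom n k + shift (binom n) k)                 ∎
  where open ≡-Reasoning

-- The algebra of the induction step of `motzkin-closedForm`. Here `x` and `y` stand for C(N, k) and
-- C(N, k - 1) with N = h + e, and `b₀`, `b₁`, `b₂` for C(2m, e), C(2m, e - 1), C(2m, e - 2), so
-- that `b₀ + 2 * b₁ + b₂` is C(2m + 2, e).
closedForm-step : ∀ h e k m x y b₀ b₁ b₂ → h + e ≡ k + m →
  e * (b₀ + 2 * b₁ + b₂) ≡ suc (suc (2 * m)) * (b₁ + b₂) → y * suc m ≡ k * x →
  suc (h + e) * (h * (x * b₀) + h * (y * (b₀ + 2 * b₁ + b₂)) + 2 * (suc h * (x * b₁)) + suc (suc h) * (x * b₂))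
  ≡ (h + e) * (suc h * ((x + y) * (b₀ + 2 * b₁ + b₂)))
closedForm-step h e k m x y b₀ b₁ b₂ h+e≡k+m absorb ratio =
  -- The added term is traded for `x * (e * G)` by `absorb`, which avoids subtraction.
  +-cancelʳ-≡ (x * (suc (suc (2 * m)) * (b₁ + b₂))) _ _ (begin
    suc (h + e) * (h * (x * b₀) + h * (y * G) + 2 * (suc h * (x * b₁)) + suc (suc h) * (x * b₂)) + x * (suc (suc (2 * m)) * (b₁ + b₂))
      ≡⟨ cong (λ t → suc (h + e) * (h * (x * b₀) + h * (y * G) + 2 * (suc h * (x * b₁)) + suc (suc h) * (x * b₂)) + x * t) (sym absorb) ⟩
    suc (h + e) * (h * (x * b₀) + h * (y * G) + 2 * (suc h * (x * b₁)) + suc (suc h) * (x * b₂)) + x * (e * G)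
      ≡⟨ left h e x y b₀ b₁ b₂ ⟩
    suc (h + e) * h * (y * G) + 2 * (h + e) * (x * (b₁ + b₂)) + 2 * (x * (b₁ + b₂)) + (h + e) * suc h * (x * G)
      ≡⟨ cong (λ t → suc (h + e) * h * (y * G) + 2 * t * (x * (b₁ + b₂)) + 2 * (x * (b₁ + b₂)) + (h + e) * suc h * (x * G)) h+e≡k+m ⟩
    suc (h + e) * h * (y * G) + 2 * (k + m) * (x * (b₁ + b₂)) + 2 * (x * (b₁ + b₂)) + (h + e) * suc h * (x * G)
      ≡⟨ middle (suc (h + e) * h * (y * G)) ((h + e) * suc h * (x * G)) k m x (b₁ + b₂) ⟩
    suc (h + e) * h * (y * G) + 2 * ((k * x) * (b₁ + b₂)) + (h + e) * suc h * (x * G) + x * (suc (suc (2 * m)) * (b₁ + b₂))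
      ≡⟨ cong (λ t → suc (h + e) * h * (y * G) + 2 * (t * (b₁ + b₂)) + (h + e) * suc h * (x * G) + x * (suc (suc (2 * m)) * (b₁ + b₂))) (sym ratio) ⟩
    suc (h + e) * h * (y * G) + 2 * ((y * suc m) * (b₁ + b₂)) + (h + e) * suc h * (x * G) + x * (suc (suc (2 * m)) * (b₁ + b₂))
      ≡⟨ cong (_+ x * (suc (suc (2 * m)) * (b₁ + b₂))) (right₁ (suc (h + e) * h * (y * G)) ((h + e) * suc h * (x * G)) m y (b₁ + b₂)) ⟩
    suc (h + e) * h * (y * G) + y * (suc (suc (2 * m)) * (b₁ + b₂)) + (h + e) * suc h * (x * G) + x * (suc (suc (2 * m)) * (b₁ + b₂))
      ≡⟨ cong (λ t → suc (h + e) * h * (y * G) + y * t + (h + e) * suc h * (x * G) + x * (suc (suc (2 * m)) * (b₁ + b₂))) (sym absorb) ⟩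
    suc (h + e) * h * (y * G) + y * (e * G) + (h + e) * suc h * (x * G) + x * (suc (suc (2 * m)) * (b₁ + b₂))
      ≡⟨ cong (_+ x * (suc (suc (2 * m)) * (b₁ + b₂))) (right₂ h e x y G) ⟩
    (h + e) * (suc h * ((x + y) * G)) + x * (suc (suc (2 * m)) * (b₁ + b₂)) ∎)
  where
  open ≡-Reasoning
  G = b₀ + 2 * b₁ + b₂
  left : ∀ h e x y b₀ b₁ b₂ →
    suc (h + e) * (h * (x * b₀) + h * (y * (b₀ + 2 * b₁ + b₂)) + 2 * (suc h * (x * b₁)) + suc (suc h) * (x * b₂)) + x * (e * (b₀ + 2 * b₁ + b₂))
    ≡ suc (h + e) * h * (y * (b₀ + 2 * b₁ + b₂)) + 2 * (h + e) * (x * (b₁ + b₂)) + 2 * (x * (b₁ + b₂)) + (h + e) * suc h * (x * (b₀ + 2 * b₁ + b₂))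
  left = ℕ-Solver.solve-∀
  middle : ∀ a b k m x c → a + 2 * (k + m) * (x * c) + 2 * (x * c) + b ≡ a + 2 * ((k * x) * c) + b + x * (suc (suc (2 * m)) * c)
  middle = ℕ-Solver.solve-∀
  right₁ : ∀ a b m y c → a + 2 * ((y * suc m) * c) + b ≡ a + y * (suc (suc (2 * m)) * c) + b
  right₁ = ℕ-Solver.solve-∀
  right₂ : ∀ h e x y g → suc (h + e) * h * (y * g) + y * (e * g) + (h + e) * suc h * (x * g) ≡ (h + e) * (suc h * ((x + y) * g))
  right₂ = ℕ-Solver.solve-∀

-- Lagrange inversion in the form n [x^n] Q^h = h [q^(n-h)] ((1+q)² + z)^n for Q = x ((1+Q)² + z).
motzkin-closedForm : ∀ n h e k m → h + e ≡ suc n → k + m ≡ suc n →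
  suc n * motzkin (replicate (suc n) 0) h k ≡ h * (binom (suc n) k * binom (2 * m) e)
motzkin-closedForm n zero e k m _ _ = *-zeroʳ (suc n)
motzkin-closedForm zero (suc zero)    zero    zero          (suc zero) refl refl = refl
motzkin-closedForm zero (suc zero)    zero    (suc zero)    zero       refl refl = refl
-- For `m = 0` every step has to contribute a factor z. With δ = 0 only up-steps do, so the last
-- step is one.
motzkin-closedForm (suc n) (suc h) e (suc k) zero h+e≡ k≡ =
  trans (cong (suc (suc n) *_) onlyUp) (*-cancelˡ-≡ _ _ (suc n) scaled)
  where
  M = motzkin (replicate (suc n) 0)
  k≡n : k ≡ suc n
  k≡n = trans (sym (+-identityʳ k)) (suc-injective k≡)
  high : ∀ h → M h (suc k) ≡ 0
  high h = motzkin-degree (replicate (suc n) 0) h (suc k)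
    (s≤s (≤-reflexive (trans (length-replicate (suc n)) (sym k≡n))))
  onlyUp : motzkin (replicate (suc (suc n)) 0) (suc h) (suc k) ≡ M h k
  onlyUp rewrite high h | high (suc h) | high (suc (suc h)) = trans (+-identityʳ _) (+-identityʳ _)
  diag : binom (suc n) k ≡ 1
  diag = trans (cong (binom (suc n)) k≡n) (binom-diag (suc n))
  diag⁺ : binom (suc (suc n)) (suc k) ≡ 1
  diag⁺ = trans (cong (λ k → binom (suc (suc n)) (suc k)) k≡n) (binom-diag (suc (suc n)))
  balance : ∀ e → h + e ≡ suc n → suc (suc n) * (h * (1 * binom 0 e)) ≡ suc n * (suc h * (1 * binom 0 e))
  balance zero    h≡ rewrite +-identityʳ h | h≡ = swap n
    where
    swap : ∀ n → suc (suc n) * (suc n * 1) ≡ suc n * (suc (suc n) * 1)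
    swap = ℕ-Solver.solve-∀
  balance (suc e) h≡ rewrite *-zeroʳ h | *-zeroʳ n = refl
  scaled : suc n * (suc (suc n) * M h k) ≡ suc n * (suc h * (binom (suc (suc n)) (suc k) * binom 0 e))
  scaled = begin
    suc n * (suc (suc n) * M h k)                       ≡⟨ swap (suc n) (suc (suc n)) (M h k) ⟩
    suc (suc n) * (suc n * M h k)                       ≡⟨ cong (suc (suc n) *_) (motzkin-closedForm n h e k 0 (suc-injective h+e≡) (suc-injective k≡)) ⟩
    suc (suc n) * (h * (binom (suc n) k * binom 0 e))   ≡⟨ cong (λ b → suc (suc n) * (h * (b * binom 0 e))) diag ⟩
    suc (suc n) * (h * (1 * binom 0 e))                 ≡⟨ balance e (suc-injective h+e≡) ⟩
    suc n * (suc h * (1 * binom 0 e))                   ≡⟨ cong (λ b → suc n * (suc h * (b * binom 0 e))) (sym diag⁺) ⟩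
    suc n * (suc h * (binom (suc (suc n)) (suc k) * binom 0 e)) ∎
    where
    open ≡-Reasoning
    swap : ∀ a b c → a * (b * c) ≡ b * (a * c)
    swap = ℕ-Solver.solve-∀
-- The induction hypothesis gives the values for `suc n` steps only multiplied by `suc n`, so this
-- factor is put in and cancelled at the end.
motzkin-closedForm (suc n) (suc h) e k (suc m) h+e≡ k+m≡ = *-cancelˡ-≡ _ _ (suc n) (begin
  suc n * (suc (suc n) * (M h k + shift (M h) k + (2 * M (suc h) k + 0) + M (suc (suc h)) k))
    ≡⟨ distribute (suc n) (M h k) (shift (M h) k) (M (suc h) k) (M (suc (suc h)) k) ⟩
  suc (suc n) * (suc n * M h k + suc n * shift (M h) k + 2 * (suc n * M (suc h) k) + suc n * M (suc (suc h)) k)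
    ≡⟨ cong (suc (suc n) *_) (cong₂ _+_ (cong₂ _+_ (cong₂ _+_ z₀ (zk k k+m≡)) (cong (2 *_) z₁)) z₂) ⟩
  suc (suc n) * (h * (x * b₀) + h * (shift (binom (suc n)) k * (b₀ + 2 * b₁ + b₂)) + 2 * (suc h * (x * b₁)) + suc (suc h) * (x * b₂))
    ≡⟨ cong (λ N → suc N * (h * (x * b₀) + h * (shift (binom (suc n)) k * (b₀ + 2 * b₁ + b₂)) + 2 * (suc h * (x * b₁)) + suc (suc h) * (x * b₂))) (sym n≡) ⟩
  suc (h + e) * (h * (x * b₀) + h * (shift (binom (suc n)) k * (b₀ + 2 * b₁ + b₂)) + 2 * (suc h * (x * b₁)) + suc (suc h) * (x * b₂))
    ≡⟨ closedForm-step h e k m x (shift (binom (suc n)) k) b₀ b₁ b₂ (trans n≡ (sym k+m≡n)) (binom-absorb² (2 * m) e) (ratio k k+m≡) ⟩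
  (h + e) * (suc h * ((x + shift (binom (suc n)) k) * (b₀ + 2 * b₁ + b₂)))
    ≡⟨ cong₂ (λ N b → N * (suc h * b)) n≡
         (cong₂ _*_ (sym (binom-suc (suc n) k)) (sym b≡)) ⟩
  suc n * (suc h * (binom (suc (suc n)) k * binom (2 * suc m) e)) ∎)
  where
  open ≡-Reasoning
  M = motzkin (replicate (suc n) 0)
  x = binom (suc n) k
  b₀ = binom (2 * m) e
  b₁ = shift (binom (2 * m)) e
  b₂ = shift (shift (binom (2 * m))) e
  n≡ : h + e ≡ suc n
  n≡ = suc-injective h+e≡
  k+m≡n : k + m ≡ suc n
  k+m≡n = suc-injective (trans (sym (+-suc k m)) k+m≡)
  b≡ : binom (2 * suc m) e ≡ b₀ + 2 * b₁ + b₂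
  b≡ = trans (cong (λ N → binom N e) (*-suc 2 m)) (binom-suc² (2 * m) e)
  distribute : ∀ n a b c d → n * (suc n * (a + b + (2 * c + 0) + d)) ≡ suc n * (n * a + n * b + 2 * (n * c) + n * d)
  distribute = ℕ-Solver.solve-∀
  tooHigh : ∀ h → suc n < h → suc n * M h k ≡ h * (x * 0)
  tooHigh h n<h = trans (cong (suc n *_) (motzkin-high (replicate (suc n) 0) h k (subst (_< h) (sym (length-replicate (suc n))) n<h)))
    (trans (*-zeroʳ (suc n)) (sym (trans (cong (h *_) (*-zeroʳ x)) (*-zeroʳ h))))
  z₀ : suc n * M h k ≡ h * (x * b₀)
  z₀ = motzkin-closedForm n h e k m n≡ k+m≡n
  step : ∀ e → h + suc e ≡ suc n → suc h + e ≡ suc n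
  step e p = trans (sym (+-suc h e)) p
  -- For small `e` the greater heights exceed the number of steps, and both sides are 0; otherwise
  -- the induction hypothesis applies with a smaller `e`.
  above : ∀ e → h + e ≡ suc n → suc n * M (suc h) k ≡ suc h * (x * shift (binom (2 * m)) e)
  above zero    p = tooHigh (suc h) (s≤s (≤-reflexive (trans (sym p) (+-identityʳ h))))
  above (suc e) p = motzkin-closedForm n (suc h) e k m (step e p) k+m≡n
  above² : ∀ e → h + e ≡ suc n → suc n * M (suc (suc h)) k ≡ suc (suc h) * (x * shift (shift (binom (2 * m))) e)
  above² zero          p = tooHigh (suc (suc h)) (m<n⇒m<1+n (s≤s (≤-reflexive (trans (sym p) (+-identityʳ h)))))
  above² (suc zero)    p = tooHigh (suc (suc h)) (s≤s (≤-reflexive (trans (sym p) (+-comm h 1))))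
  above² (suc (suc e)) p = motzkin-closedForm n (suc (suc h)) e k m (trans (cong suc (sym (+-suc h e))) (step (suc e) p)) k+m≡n
  z₁ = above e n≡
  z₂ = above² e n≡
  zk : ∀ k → k + suc m ≡ suc (suc n) → suc n * shift (M h) k ≡ h * (shift (binom (suc n)) k * (b₀ + 2 * b₁ + b₂))
  zk zero    _ = trans (*-zeroʳ (suc n)) (sym (*-zeroʳ h))
  zk (suc k) p = trans (motzkin-closedForm n h e k (suc m) n≡ (suc-injective p)) (cong (λ b → h * (binom (suc n) k * b)) b≡)
  ratio : ∀ k → k + suc m ≡ suc (suc n) → shift (binom (suc n)) k * suc m ≡ k * binom (suc n) k
  ratio zero    _ = refl
  ratio (suc k) p = trans (*-comm _ (suc m)) (sym (subst (λ N → suc k * binom N (suc k) ≡ suc m * binom N k) (suc-injective p) (binom-below k (suc m))))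

-- Induction on k with m fixed: raising k multiplies both sides by the same ratio as long as k ≤ m +
-- 1, and beyond that both sides are 0.
catalan-binom : ∀ k m n → k + m ≡ suc n →
  binom (k + m) k * binom (2 * m) n * suc m ≡ suc n * (binom (2 * m) m * binom (suc m) k)
catalan-binom zero (suc n) n refl = trans (lhs (binom (2 * suc n) n) n)
  (trans (sym middle) (rhs (suc n) (binom (2 * suc n) (suc n))))
  where
  lhs : ∀ b n → 1 * b * suc (suc n) ≡ suc (suc n) * b
  lhs = ℕ-Solver.solve-∀
  rhs : ∀ n b → n * b ≡ n * (b * 1)
  rhs = ℕ-Solver.solve-∀
  split : ∀ n b → 2 * suc n * b ≡ suc (suc n) * b + n * b
  split = ℕ-Solver.solve-∀
  middle : suc n * binom (2 * suc n) (suc n) ≡ suc (suc n) * binom (2 * suc n) n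
  middle = +-cancelʳ-≡ (n * binom (2 * suc n) n) _ _ (trans (binom-shift (2 * suc n) n) (split n (binom (2 * suc n) n)))
catalan-binom (suc zero) zero zero refl = refl
catalan-binom (suc k) m (suc n) p with ≤-total k (suc m)
... | inj₂ 1+m≤k = trans (cong (λ b → binom (suc k + m) (suc k) * b * suc m) (binom-zero 2m<1+n))
    (trans (cong (_* suc m) (*-zeroʳ (binom (suc k + m) (suc k))))
    (sym (trans (cong (λ b → suc (suc n) * (binom (2 * m) m * b)) (binom-zero (s≤s 1+m≤k)))
    (trans (cong (suc (suc n) *_) (*-zeroʳ (binom (2 * m) m))) (*-zeroʳ (suc (suc n)))))))
  where
  2m<1+n : 2 * m < suc n
  2m<1+n = subst (2 * m <_) (suc-injective p)
    (≤-trans (s≤s (≤-reflexive (cong (λ w → m + w) (+-identityʳ m)))) (+-monoˡ-≤ m 1+m≤k))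
... | inj₁ k≤1+m with m≤n⇒∃[o]m+o≡n k≤1+m
-- The number `j` is both m + 1 - k and 2m - n, so it occurs in the ratio of `W′` to `W` and in that
-- of `Y′` to `Y`.
...   | j , k+j≡1+m = *-cancelˡ-≡ _ _ (suc k) (*-cancelˡ-≡ _ _ (suc n) (begin
    suc n * (suc k * (X′ * Y′ * suc m))             ≡⟨ lhs (suc n) (suc k) X′ Y′ (suc m) ⟩
    (suc k * X′) * (suc n * Y′) * suc m             ≡⟨ cong₂ (λ a b → a * b * suc m) (binom-absorb (k + m) k) y ⟩
    suc (k + m) * X * (j * Y) * suc m               ≡⟨ cong (λ N → suc N * X * (j * Y) * suc m) q ⟩
    suc (suc n) * X * (j * Y) * suc m               ≡⟨ group (suc (suc n)) X j Y (suc m) ⟩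
    suc (suc n) * j * (X * Y * suc m)               ≡⟨ cong (suc (suc n) * j *_) (catalan-binom k m n q) ⟩
    suc (suc n) * j * (suc n * (B * W))             ≡⟨ regroup (suc (suc n)) j (suc n) B W ⟩
    suc n * (suc (suc n) * (B * (j * W)))           ≡⟨ cong (λ b → suc n * (suc (suc n) * (B * b))) (sym w) ⟩
    suc n * (suc (suc n) * (B * (suc k * W′)))      ≡⟨ rhs (suc n) (suc (suc n)) B (suc k) W′ ⟩
    suc n * (suc k * (suc (suc n) * (B * W′)))      ∎))
  where
  open ≡-Reasoning
  X  = binom (k + m) k
  X′ = binom (suc k + m) (suc k)
  Y  = binom (2 * m) n
  Y′ = binom (2 * m) (suc n)
  B  = binom (2 * m) m
  W  = binom (suc m) k
  W′ = binom (suc m) (suc k)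
  q : k + m ≡ suc n
  q = suc-injective p
  w : suc k * W′ ≡ j * W
  w = subst (λ N → suc k * binom N (suc k) ≡ j * binom N k) k+j≡1+m (binom-below k j)
  n+j≡2m : n + j ≡ 2 * m
  n+j≡2m = suc-injective (trans (cong (_+ j) (sym q)) (trans (swap k m j) (trans (cong (_+ m) k+j≡1+m) (cong (λ x → suc (m + x)) (sym (+-identityʳ m))))))
    where
    swap : ∀ k m j → k + m + j ≡ k + j + m
    swap = ℕ-Solver.solve-∀
  y : suc n * Y′ ≡ j * Y
  y = subst (λ N → suc n * binom N (suc n) ≡ j * binom N n) n+j≡2m (binom-below n j)
  lhs : ∀ n k x y m → n * (k * (x * y * m)) ≡ (k * x) * (n * y) * m
  lhs = ℕ-Solver.solve-∀
  group : ∀ N x j y m → N * x * (j * y) * m ≡ N * j * (x * y * m)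
  group = ℕ-Solver.solve-∀
  regroup : ∀ N j n b w → N * j * (n * (b * w)) ≡ n * (N * (b * (j * w)))
  regroup = ℕ-Solver.solve-∀
  rhs : ∀ n N b k w → n * (N * (b * (k * w))) ≡ n * (k * (N * (b * w)))
  rhs = ℕ-Solver.solve-∀

-- The closed form at h = 1, where `catalan-binom` and `catalan-spec` combine the central binomial
-- coefficient into a Catalan number.
motzkin-plain : ∀ n k m → k + m ≡ suc n → motzkin (replicate (suc n) 0) 1 k ≡ catalan m * binom (suc m) k
motzkin-plain n k m k+m≡ = *-cancelˡ-≡ _ _ (suc n) (*-cancelʳ-≡ _ _ (suc m) (begin
  suc n * motzkin (replicate (suc n) 0) 1 k * suc m       ≡⟨ cong (_* suc m) (motzkin-closedForm n 1 n k m refl k+m≡) ⟩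
  1 * (binom (suc n) k * binom (2 * m) n) * suc m         ≡⟨ cong (_* suc m) (*-identityˡ (binom (suc n) k * binom (2 * m) n)) ⟩
  binom (suc n) k * binom (2 * m) n * suc m               ≡⟨ cong (λ N → binom N k * binom (2 * m) n * suc m) (sym k+m≡) ⟩
  binom (k + m) k * binom (2 * m) n * suc m               ≡⟨ catalan-binom k m n k+m≡ ⟩
  suc n * (binom (2 * m) m * binom (suc m) k)             ≡⟨ cong (λ b → suc n * (b * binom (suc m) k)) (sym (catalan-spec m)) ⟩
  suc n * (catalan m * suc m * binom (suc m) k)           ≡⟨ regroup (suc n) (catalan m) (suc m) (binom (suc m) k) ⟩
  suc n * (catalan m * binom (suc m) k) * suc m           ∎))
  where
  open ≡-Reasoning
  regroup : ∀ n c m b → n * (c * m * b) ≡ n * (c * b) * m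
  regroup = ℕ-Solver.solve-∀

-- Deleting level steps down to δ = 0

replicate-suc : ∀ {A : Set} n (x : A) xs → replicate (suc n) x ++ xs ≡ replicate n x ++ x ∷ xs
replicate-suc zero    x xs = refl
replicate-suc (suc n) x xs = cong (x ∷_) (replicate-suc n x xs)

-- The δ's for i = suc c and j = a; the one of label 1, which is never a level step, is irrelevant.
slopes : ℕ → ℕ → ℕ → List ℕ
slopes a b c = replicate a 2 ++ replicate b 0 ++ replicate (suc c) 1

slopes-start : ∀ b c k → motzkin (replicate b 0 ++ replicate (suc c) 1) 0 k ≡ 0
slopes-start zero    c k = refl
slopes-start (suc b) c k = refl

-- Lowering the δ of label i from 1 to 0 splits off z times the paths without that step, in parallel
-- with Pascal's rule on the right. A deletion lowers the length and k together, so m and its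
-- Catalan factor persist.
motzkin-slopes₀ : ∀ b c k m → k + m ≡ b + suc c →
  motzkin (slopes 0 b c) 1 k ≡ catalan m * binom (m + suc c) k
motzkin-slopes₀ b zero k m k+m≡ = trans
  (motzkin-congˡ (replicate b 0) firstLevel 1 k)
  (trans (cong (λ δs → motzkin δs 1 k) (sym (trans (sym (++-identityʳ _)) (replicate-suc b 0 []))))
  (trans (motzkin-plain b k m (trans k+m≡ (+-comm b 1))) (cong (λ N → catalan m * binom N k) (+-comm 1 m))))
  where
  -- The first step leaves height 0 and is an up-step, so its δ can be changed to 0.
  firstLevel : ∀ h k → motzkin (1 ∷ []) h k ≡ motzkin (0 ∷ []) h k
  firstLevel zero    k       = refl
  firstLevel (suc h) zero    = refl
  firstLevel (suc h) (suc k) = refl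
motzkin-slopes₀ b (suc c) k m k+m≡ = begin
  motzkin (replicate b 0 ++ 1 ∷ replicate (suc c) 1) 1 k
    ≡⟨ motzkin-delete (replicate b 0) 0 (replicate (suc c) 1) (λ _ → refl) 1 k ⟩
  motzkin (replicate b 0 ++ 0 ∷ replicate (suc c) 1) 1 k + shift (motzkin (slopes 0 b c) 1) k
    ≡⟨ cong₂ _+_ (trans (cong (λ δs → motzkin δs 1 k) (sym (replicate-suc b 0 _))) (motzkin-slopes₀ (suc b) c k m k+m≡′)) (deleted k k+m≡′) ⟩
  catalan m * binom (m + suc c) k + catalan m * shift (binom (m + suc c)) k
    ≡⟨ sym (*-distribˡ-+ (catalan m) (binom (m + suc c) k) _) ⟩
  catalan m * (binom (m + suc c) k + shift (binom (m + suc c)) k)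
    ≡⟨ cong (catalan m *_) (sym (binom-suc (m + suc c) k)) ⟩
  catalan m * binom (suc (m + suc c)) k
    ≡⟨ cong (λ N → catalan m * binom N k) (sym (+-suc m (suc c))) ⟩
  catalan m * binom (m + suc (suc c)) k ∎
  where
  open ≡-Reasoning
  k+m≡′ : k + m ≡ suc b + suc c
  k+m≡′ = trans k+m≡ (+-suc b (suc c))
  deleted : ∀ k → k + m ≡ suc b + suc c → shift (motzkin (slopes 0 b c) 1) k ≡ catalan m * shift (binom (m + suc c)) k
  deleted zero    _ = sym (*-zeroʳ (catalan m))
  deleted (suc k) p = motzkin-slopes₀ b c k m (suc-injective p)

-- Two deletions lower the δ of label d - j from 2 to 0 and produce the factor 2 z that
-- `binomialSum-suc` has on the other side.
motzkin-slopes : ∀ a b c k m → k + m ≡ a + (b + suc c) →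
  motzkin (slopes a b c) 1 k ≡ catalan m * binomialSum a (diagBinom (a + (m + suc c)) k)
motzkin-slopes zero    b c k m k+m≡ = motzkin-slopes₀ b c k m k+m≡
motzkin-slopes (suc a) b c k m k+m≡ = begin
  motzkin (slopes (suc a) b c) 1 k
    ≡⟨ cong (λ δs → motzkin δs 1 k) (replicate-suc a 2 γs) ⟩
  motzkin (replicate a 2 ++ 2 ∷ γs) 1 k
    ≡⟨ motzkin-delete (replicate a 2) 1 γs (slopes-start b c) 1 k ⟩
  motzkin (replicate a 2 ++ 1 ∷ γs) 1 k + shift (motzkin (slopes a b c) 1) k
    ≡⟨ cong (_+ shift (motzkin (slopes a b c) 1) k) (motzkin-delete (replicate a 2) 0 γs (slopes-start b c) 1 k) ⟩
  motzkin (slopes a (suc b) c) 1 k + shift (motzkin (slopes a b c) 1) k + shift (motzkin (slopes a b c) 1) k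
    ≡⟨ cong₂ (λ x y → x + y + y) (motzkin-slopes a (suc b) c k m (trans k+m≡ (sym (+-suc a (b + suc c))))) (deleted k k+m≡) ⟩
  catalan m * F k + catalan m * shift F k + catalan m * shift F k
    ≡⟨ collect (catalan m) (F k) (shift F k) ⟩
  catalan m * (F k + 2 * shift F k)
    ≡⟨ cong (catalan m *_) (sym (binomialSum-suc a (a + (m + suc c)) k (m≤m+n a _))) ⟩
  catalan m * binomialSum (suc a) (diagBinom (suc a + (m + suc c)) k) ∎
  where
  open ≡-Reasoning
  γs = replicate b 0 ++ replicate (suc c) 1
  F : ℕ → ℕ
  F k = binomialSum a (diagBinom (a + (m + suc c)) k)
  collect : ∀ c x y → c * x + c * y + c * y ≡ c * (x + 2 * y)
  collect = ℕ-Solver.solve-∀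
  deleted : ∀ k → k + m ≡ suc (a + (b + suc c)) → shift (motzkin (slopes a b c) 1) k ≡ catalan m * shift F k
  deleted zero    _ = sym (*-zeroʳ (catalan m))
  deleted (suc k) p = motzkin-slopes a b c k m (suc-injective p)

-- The substitution z = y − 1

shiftℤ : (ℕ → ℤ) → ℕ → ℤ
shiftℤ f zero    = + 0
shiftℤ f (suc m) = f m

-- The coefficient of y^m in (y - 1)^k.
signedBinom : ℕ → ℕ → ℤ
signedBinom zero    zero    = + 1
signedBinom zero    (suc m) = + 0
signedBinom (suc k) m       = shiftℤ (signedBinom k) m ℤ.- signedBinom k m

-- The coefficient of y^m in Σ_{k<K} F k z^k under the substitution z = y - 1.
substitute : ℕ → (ℕ → ℕ) → ℕ → ℤ
substitute zero    F m = + 0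
substitute (suc K) F m = substitute K F m ℤ.+ + F K ℤ.* signedBinom K m

substitute-cong : ∀ K {F G} → (∀ k → k < K → F k ≡ G k) → ∀ m → substitute K F m ≡ substitute K G m
substitute-cong zero    F≗G m = refl
substitute-cong (suc K) F≗G m =
  cong₂ ℤ._+_ (substitute-cong K (λ k k<K → F≗G k (m<n⇒m<1+n k<K)) m)
              (cong (λ x → + x ℤ.* signedBinom K m) (F≗G K (n<1+n K)))

substitute-zero : ∀ K {F} → (∀ k → F k ≡ 0) → ∀ m → substitute K F m ≡ + 0
substitute-zero zero    F≗0 m = refl
substitute-zero (suc K) F≗0 m rewrite F≗0 K = trans (ℤ.+-identityʳ _) (substitute-zero K F≗0 m)

substitute-constant : ∀ K {F} → (∀ k → F (suc k) ≡ 0) → ∀ m → substitute (suc K) F m ≡ + F 0 ℤ.* signedBinom 0 m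
substitute-constant zero    F≗0 m = ℤ.+-identityˡ _
substitute-constant (suc K) F≗0 m rewrite F≗0 K = trans (ℤ.+-identityʳ _) (substitute-constant K F≗0 m)

substitute-+ : ∀ K F G m → substitute K (λ k → F k + G k) m ≡ substitute K F m ℤ.+ substitute K G m
substitute-+ zero    F G m = refl
substitute-+ (suc K) F G m = trans (cong (ℤ._+ (+ F K ℤ.+ + G K) ℤ.* signedBinom K m) (substitute-+ K F G m))
  (distribute (substitute K F m) (substitute K G m) (+ F K) (+ G K) (signedBinom K m))
  where
  distribute : ∀ a b f g e → a ℤ.+ b ℤ.+ (f ℤ.+ g) ℤ.* e ≡ a ℤ.+ f ℤ.* e ℤ.+ (b ℤ.+ g ℤ.* e)
  distribute = ℤ-Solver.solve-∀

substitute-* : ∀ K c F m → substitute K (λ k → c * F k) m ≡ + c ℤ.* substitute K F m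
substitute-* zero    c F m = sym (ℤ.*-zeroʳ (+ c))
substitute-* (suc K) c F m = trans (cong₂ (λ a b → a ℤ.+ b ℤ.* signedBinom K m) (substitute-* K c F m) (ℤ.pos-* c (F K)))
  (distribute (+ c) (substitute K F m) (+ F K) (signedBinom K m))
  where
  distribute : ∀ c a f e → c ℤ.* a ℤ.+ c ℤ.* f ℤ.* e ≡ c ℤ.* (a ℤ.+ f ℤ.* e)
  distribute = ℤ-Solver.solve-∀

-- The identity y F = z F + F, as y = z + 1. Multiplication by z raises the degree, hence `suc K`.
substitute-shift : ∀ K F m → shiftℤ (substitute K F) m ≡ substitute (suc K) (shift F) m ℤ.+ substitute K F m
substitute-shift zero    F zero    = refl
substitute-shift zero    F (suc m) = refl
substitute-shift (suc K) F zero    =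
  trans (step (substitute K F 0) (+ F K) (signedBinom K 0))
    (cong (λ a → a ℤ.+ + F K ℤ.* (+ 0 ℤ.- signedBinom K 0) ℤ.+ (substitute K F 0 ℤ.+ + F K ℤ.* signedBinom K 0)) (uncancel (substitute K F 0) (substitute (suc K) (shift F) 0) (substitute-shift K F 0)))
  where
  step : ∀ a f e → + 0 ≡ ℤ.- a ℤ.+ f ℤ.* (+ 0 ℤ.- e) ℤ.+ (a ℤ.+ f ℤ.* e)
  step = ℤ-Solver.solve-∀
  uncancel : ∀ a b → + 0 ≡ b ℤ.+ a → ℤ.- a ≡ b
  uncancel a b p = trans (sym (ℤ.+-identityˡ _)) (trans (cong (ℤ._+ ℤ.- a) p) (cancel b a))
    where
    cancel : ∀ b a → b ℤ.+ a ℤ.+ ℤ.- a ≡ b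
    cancel = ℤ-Solver.solve-∀
substitute-shift (suc K) F (suc m) =
  trans (cong (ℤ._+ + F K ℤ.* signedBinom K m) (substitute-shift K F (suc m)))
    (regroup (substitute (suc K) (shift F) (suc m)) (substitute K F (suc m)) (+ F K) (signedBinom K m) (signedBinom K (suc m)))
  where
  regroup : ∀ a b f e e′ → a ℤ.+ b ℤ.+ f ℤ.* e ≡ a ℤ.+ f ℤ.* (e ℤ.- e′) ℤ.+ (b ℤ.+ f ℤ.* e′)
  regroup = ℤ-Solver.solve-∀

bit : Bool → ℕ
bit b = if b then 1 else 0

weigh : Bool → (ℕ → ℕ) → ℕ → ℕ
weigh true  f = shift f
weigh false f = f

module _ (ωˡ ωʳ : ℕ → Bool) where

  -- The same paths sorted by powers of y. The four summands correspond to a last vertex with no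
  -- subtree, only a left one, only a right one, or two.
  pathCount : ℕ → ℕ → ℕ → ℕ
  pathCount zero    zero    zero    = 1
  pathCount zero    zero    (suc m) = 0
  pathCount zero    (suc h) m       = 0
  pathCount (suc n) zero    m       = 0
  pathCount (suc n) (suc h) m       =
    shift (pathCount n h) m
    + (weigh (ωˡ (suc n)) (pathCount n (suc h)) m
    + (weigh (ωʳ (suc n)) (pathCount n (suc h)) m
    + pathCount n (suc (suc h)) m))

  -- A level step of either kind weighs y = 1 + z or 1, so the two kinds together weigh 2 + δ z,
  -- where δ is the number of those with weight y.
  slopeList : ℕ → List ℕ
  slopeList zero    = []
  slopeList (suc n) = bit (ωˡ (suc n)) + bit (ωʳ (suc n)) ∷ slopeList n

  -- The recursions agree under y = 1 + z. `K` is any bound above the degree, so that the induction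
  -- hypothesis is available at two consecutive bounds.
  pathCount≡ : ∀ n h m K → n < K → + pathCount n h m ≡ substitute K (motzkin (slopeList n) h) m
  pathCount≡ zero    zero    zero    (suc K) _ = sym (substitute-constant K (λ _ → refl) 0)
  pathCount≡ zero    zero    (suc m) (suc K) _ = sym (substitute-constant K (λ _ → refl) (suc m))
  pathCount≡ zero    (suc h) m       K       _ = sym (substitute-zero K (λ _ → refl) m)
  pathCount≡ (suc n) zero    m       K       _ = sym (substitute-zero K (λ _ → refl) m)
  pathCount≡ (suc n) (suc h) m (suc K) (s≤s n<K) = begin
    + shift (pathCount n h) m ℤ.+ (+ weigh (ωˡ (suc n)) (pathCount n (suc h)) m
      ℤ.+ (+ weigh (ωʳ (suc n)) (pathCount n (suc h)) m ℤ.+ + pathCount n (suc (suc h)) m))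
      ≡⟨ cong₂ ℤ._+_ (shifted h) (cong₂ ℤ._+_ (weighed (ωˡ (suc n)) (suc h))
           (cong₂ ℤ._+_ (weighed (ωʳ (suc n)) (suc h)) (pathCount≡ n (suc (suc h)) m (suc K) (m<n⇒m<1+n n<K)))) ⟩
    A h ℤ.+ S h ℤ.+ (A (suc h) ℤ.+ + bit (ωˡ (suc n)) ℤ.* S (suc h)
      ℤ.+ (A (suc h) ℤ.+ + bit (ωʳ (suc n)) ℤ.* S (suc h) ℤ.+ A (suc (suc h))))
      ≡⟨ collect (+ bit (ωˡ (suc n))) (+ bit (ωʳ (suc n))) (A h) (S h) (A (suc h)) (S (suc h)) (A (suc (suc h))) ⟩
    A h ℤ.+ S h ℤ.+ (+ 2 ℤ.* A (suc h) ℤ.+ (+ bit (ωˡ (suc n)) ℤ.+ + bit (ωʳ (suc n))) ℤ.* S (suc h)) ℤ.+ A (suc (suc h))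
      ≡⟨ sym linear ⟩
    substitute (suc K) (motzkin (slopeList (suc n)) (suc h)) m ∎
    where
    open ≡-Reasoning
    M : ℕ → ℕ → ℕ
    M = motzkin (slopeList n)
    A S : ℕ → ℤ
    A h = substitute (suc K) (M h) m
    S h = substitute (suc K) (shift (M h)) m
    shift-pos : ∀ f m → + shift f m ≡ shiftℤ (λ m → + f m) m
    shift-pos f zero    = refl
    shift-pos f (suc m) = refl
    shiftℤ-cong : ∀ {f g : ℕ → ℤ} → (∀ m → f m ≡ g m) → ∀ m → shiftℤ f m ≡ shiftℤ g m
    shiftℤ-cong f≗g zero    = refl
    shiftℤ-cong f≗g (suc m) = f≗g m
    same : ∀ h → substitute K (M h) m ≡ A h
    -- Truncating at `K` and at `suc K` gives the same value because both are the path count.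
    same h = trans (sym (pathCount≡ n h m K n<K)) (pathCount≡ n h m (suc K) (m<n⇒m<1+n n<K))
    shifted : ∀ h → + shift (pathCount n h) m ≡ A h ℤ.+ S h
    shifted h = begin
      + shift (pathCount n h) m              ≡⟨ shift-pos (pathCount n h) m ⟩
      shiftℤ (λ m → + pathCount n h m) m     ≡⟨ shiftℤ-cong (λ m → pathCount≡ n h m K n<K) m ⟩
      shiftℤ (substitute K (M h)) m          ≡⟨ substitute-shift K (M h) m ⟩
      S h ℤ.+ substitute K (M h) m           ≡⟨ cong (λ x → S h ℤ.+ x) (same h) ⟩
      S h ℤ.+ A h                            ≡⟨ ℤ.+-comm (S h) (A h) ⟩
      A h ℤ.+ S h                            ∎
    weighed : ∀ b h → + weigh b (pathCount n h) m ≡ A h ℤ.+ + bit b ℤ.* S h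
    weighed true  h = trans (shifted h) (cong (λ x → A h ℤ.+ x) (sym (ℤ.*-identityˡ (S h))))
    weighed false h = trans (pathCount≡ n h m (suc K) (m<n⇒m<1+n n<K)) (sym (ℤ.+-identityʳ (A h)))
    collect : ∀ l r a s b t c → a ℤ.+ s ℤ.+ (b ℤ.+ l ℤ.* t ℤ.+ (b ℤ.+ r ℤ.* t ℤ.+ c))
            ≡ a ℤ.+ s ℤ.+ (+ 2 ℤ.* b ℤ.+ (l ℤ.+ r) ℤ.* t) ℤ.+ c
    collect = ℤ-Solver.solve-∀
    δ : ℕ
    δ = bit (ωˡ (suc n)) + bit (ωʳ (suc n))
    linear : substitute (suc K) (motzkin (slopeList (suc n)) (suc h)) m
           ≡ A h ℤ.+ S h ℤ.+ (+ 2 ℤ.* A (suc h) ℤ.+ + δ ℤ.* S (suc h)) ℤ.+ A (suc (suc h))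
    linear =
      trans (substitute-+ (suc K) (λ k → M h k + shift (M h) k + (2 * M (suc h) k + δ * shift (M (suc h)) k)) (M (suc (suc h))) m)
      (cong (ℤ._+ A (suc (suc h)))
        (trans (substitute-+ (suc K) (λ k → M h k + shift (M h) k) (λ k → 2 * M (suc h) k + δ * shift (M (suc h)) k) m)
        (cong₂ ℤ._+_ (substitute-+ (suc K) (M h) (shift (M h)) m)
          (trans (substitute-+ (suc K) (λ k → 2 * M (suc h) k) (λ k → δ * shift (M (suc h)) k) m)
            (cong₂ ℤ._+_ (substitute-* (suc K) 2 (M (suc h)) m) (substitute-* (suc K) δ (shift (M (suc h))) m))))))

-- Coefficients of f_d

coeff-padd : ∀ p q n → coeff (padd p q) n ≡ coeff p n ℤ.+ coeff q n
coeff-padd []      q       n       = sym (ℤ.+-identityˡ _)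
coeff-padd (a ∷ p) []      zero    = sym (ℤ.+-identityʳ _)
coeff-padd (a ∷ p) []      (suc n) = sym (ℤ.+-identityʳ _)
coeff-padd (a ∷ p) (b ∷ q) zero    = refl
coeff-padd (a ∷ p) (b ∷ q) (suc n) = coeff-padd p q n

coeff-pscale : ∀ c p n → coeff (pscale c p) n ≡ c ℤ.* coeff p n
coeff-pscale c []      n       = sym (ℤ.*-zeroʳ c)
coeff-pscale c (a ∷ p) zero    = refl
coeff-pscale c (a ∷ p) (suc n) = coeff-pscale c p n

coeff-pmul-∷ : ∀ a p q n → coeff (pmul (a ∷ p) q) n ≡ a ℤ.* coeff q n ℤ.+ shiftℤ (coeff (pmul p q)) n
coeff-pmul-∷ a p q zero    = trans (coeff-padd (pscale a q) _ 0) (cong (ℤ._+ + 0) (coeff-pscale a q 0))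
coeff-pmul-∷ a p q (suc n) = trans (coeff-padd (pscale a q) _ (suc n)) (cong (ℤ._+ coeff (pmul p q) n) (coeff-pscale a q (suc n)))

coeff-xpow-below : ∀ p r n → n < r → coeff (pmul p (xpow r)) n ≡ + 0
coeff-xpow-below []      r       n       _         = refl
coeff-xpow-below (a ∷ p) (suc r) zero    _         = trans (coeff-pmul-∷ a p (xpow (suc r)) 0) (trans (ℤ.+-identityʳ _) (ℤ.*-zeroʳ a))
coeff-xpow-below (a ∷ p) (suc r) (suc n) (s≤s n<r) =
  trans (coeff-pmul-∷ a p (xpow (suc r)) (suc n))
  (trans (cong₂ (λ x y → a ℤ.* x ℤ.+ y) (gap r n n<r) (coeff-xpow-below p (suc r) n (m<n⇒m<1+n n<r)))
  (trans (ℤ.+-identityʳ _) (ℤ.*-zeroʳ a)))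
  where
  gap : ∀ r n → n < r → coeff (xpow r) n ≡ + 0
  gap (suc r) zero    _         = refl
  gap (suc r) (suc n) (s≤s n<r) = gap r n n<r

coeff-xpow-shift : ∀ p r s → coeff (pmul p (xpow r)) (r + s) ≡ coeff p s
coeff-xpow-shift []      r s       = refl
coeff-xpow-shift (a ∷ p) r zero    rewrite +-identityʳ r =
  trans (coeff-pmul-∷ a p (xpow r) r)
    (trans (cong₂ ℤ._+_ (trans (cong (a ℤ.*_) (lead r)) (ℤ.*-identityʳ a)) (low r)) (ℤ.+-identityʳ a))
  where
  lead : ∀ r → coeff (xpow r) r ≡ + 1
  lead zero    = refl
  lead (suc r) = lead r
  low : ∀ r → shiftℤ (coeff (pmul p (xpow r))) r ≡ + 0
  low zero    = refl
  low (suc r) = coeff-xpow-below p (suc r) r (n<1+n r)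
coeff-xpow-shift (a ∷ p) r (suc s) rewrite +-suc r s =
  trans (coeff-pmul-∷ a p (xpow r) (suc (r + s)))
    (trans (cong₂ ℤ._+_ (trans (cong (a ℤ.*_) (beyond r)) (ℤ.*-zeroʳ a)) (coeff-xpow-shift p r s)) (ℤ.+-identityˡ _))
  where
  beyond : ∀ r → coeff (xpow r) (suc (r + s)) ≡ + 0
  beyond zero    = refl
  beyond (suc r) = beyond r

coeff-oneMinusX : ∀ k n → coeff (ppow oneMinusX (suc k)) n ≡ coeff (ppow oneMinusX k) n ℤ.- shiftℤ (coeff (ppow oneMinusX k)) n
coeff-oneMinusX k n = trans (coeff-pmul-∷ (+ 1) (-[1+ 0 ] ∷ []) P n) (cong₂ ℤ._+_ (ℤ.*-identityˡ (coeff P n)) (tail n))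
  where
  P = ppow oneMinusX k
  tail : ∀ n → shiftℤ (coeff (pmul (-[1+ 0 ] ∷ []) P)) n ≡ ℤ.- shiftℤ (coeff P) n
  tail zero    = refl
  tail (suc n) = trans (coeff-pmul-∷ -[1+ 0 ] [] P n) (trans (cong₂ ℤ._+_ (ℤ.-1*i≡-i (coeff P n)) (empty n)) (ℤ.+-identityʳ _))
    where
    empty : ∀ n → shiftℤ (coeff []) n ≡ + 0
    empty zero    = refl
    empty (suc n) = refl

oneMinusX-degree : ∀ k n → k < n → coeff (ppow oneMinusX k) n ≡ + 0
oneMinusX-degree zero    (suc n) _         = refl
oneMinusX-degree (suc k) (suc n) (s≤s k<n) = trans (coeff-oneMinusX k (suc n))
  (cong₂ ℤ._-_ (oneMinusX-degree k (suc n) (m<n⇒m<1+n k<n)) (oneMinusX-degree k n k<n))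

signedBinom-zero : ∀ k m → k < m → signedBinom k m ≡ + 0
signedBinom-zero zero    (suc m) _         = refl
signedBinom-zero (suc k) (suc m) (s≤s k<m) =
  cong₂ ℤ._-_ (signedBinom-zero k m k<m) (signedBinom-zero k (suc m) (m<n⇒m<1+n k<m))

-- As (1 - x)^k = x^k (1/x - 1)^k, the coefficients of (1 - x)^k are those of (y - 1)^k in reverse
-- order.
coeff-signedBinom : ∀ k m s → m + s ≡ k → coeff (ppow oneMinusX k) s ≡ signedBinom k m
coeff-signedBinom zero    zero    zero    _    = refl
coeff-signedBinom (suc k) zero    (suc s) refl = trans (coeff-oneMinusX k (suc k))
  (cong₂ ℤ._-_ (oneMinusX-degree k (suc k) (n<1+n k)) (coeff-signedBinom k 0 k refl))
coeff-signedBinom (suc k) (suc m) zero    m+s≡ = trans (coeff-oneMinusX k 0)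
  (cong₂ ℤ._-_ (coeff-signedBinom k m 0 (suc-injective m+s≡))
               (sym (signedBinom-zero k (suc m) (s≤s (≤-reflexive (sym (trans (sym (+-identityʳ m)) (suc-injective m+s≡))))))))
coeff-signedBinom (suc k) (suc m) (suc s) m+s≡ = trans (coeff-oneMinusX k (suc s))
  (cong₂ ℤ._-_ (coeff-signedBinom k m (suc s) (suc-injective m+s≡))
               (coeff-signedBinom k (suc m) s (trans (sym (+-suc m s)) (suc-injective m+s≡))))

-- Here x^(d - k) (1 - x)^k = x^d (y - 1)^k for y = 1/x. If k < m, then d - m lies below the lowest
-- power x^(d - k).
coeff-term : ∀ d k m → k ≤ d → m ≤ d → coeff (pmul (ppow oneMinusX k) (xpow (d ∸ k))) (d ∸ m) ≡ signedBinom k m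
coeff-term d k m k≤d m≤d with ≤-<-connex m k
... | inj₁ m≤k = trans (cong (coeff (pmul (ppow oneMinusX k) (xpow (d ∸ k)))) split)
    (trans (coeff-xpow-shift (ppow oneMinusX k) (d ∸ k) (k ∸ m)) (coeff-signedBinom k m (k ∸ m) (m+[n∸m]≡n m≤k)))
  where
  split : d ∸ m ≡ d ∸ k + (k ∸ m)
  split = trans (cong (_∸ m) (sym (m∸n+n≡m k≤d))) (+-∸-assoc (d ∸ k) m≤k)
... | inj₂ k<m = trans (coeff-xpow-below (ppow oneMinusX k) (d ∸ k) (d ∸ m) (∸-monoʳ-< k<m m≤d))
    (sym (signedBinom-zero k m k<m))

coeff-fPoly : ∀ d i j m → m ≤ d → coeff (fPoly d i j) (d ∸ m) ≡ substitute d (λ k → catalan (d ∸ 1 ∸ k) * innerSum d i j k) m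
coeff-fPoly d i j m m≤d = partial d ≤-refl
  where
  F : ℕ → ℕ
  F k = catalan (d ∸ 1 ∸ k) * innerSum d i j k
  term : ℕ → Poly
  term k = pmul (ppow oneMinusX k) (xpow (d ∸ k))
  partial : ∀ K → K ≤ d → coeff (sumPoly K (λ k → pscale (+ F k) (term k))) (d ∸ m) ≡ substitute K F m
  partial zero    _   = refl
  partial (suc K) K<d =
    trans (coeff-padd (sumPoly K (λ k → pscale (+ F k) (term k))) (pscale (+ F K) (term K)) (d ∸ m))
    (cong₂ ℤ._+_ (partial K (<⇒≤ K<d))
      (trans (coeff-pscale (+ F K) (term K) (d ∸ m)) (cong (+ F K ℤ.*_) (coeff-term d K m (<⇒≤ K<d) m≤d))))

-- Plane forests as binary trees

×-irr : ∀ {A B : Set} → Irrelevant A → Irrelevant B → Irrelevant (A × B)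
×-irr irrA irrB (a , b) (a′ , b′) = cong₂ _,_ (irrA a a′) (irrB b b′)

Σ-≡ : ∀ {A : Set} {P : A → Set} → (∀ a → Irrelevant (P a)) → ∀ {a a′ p p′} → a ≡ a′ → _≡_ {A = Σ A P} (a , p) (a′ , p′)
Σ-≡ irr {a} refl = cong (a ,_) (irr a _ _)

-- The conditions are equations between numbers and hence irrelevant, so a bijection need only be
-- checked on the underlying objects.
Σ-↔ : ∀ {A B : Set} {P : A → Set} {Q : B → Set} → (∀ a → Irrelevant (P a)) → (∀ b → Irrelevant (Q b)) →
  (f : A → B) (g : B → A) → (∀ a → P a → Q (f a)) → (∀ b → Q b → P (g b)) →
  (∀ b → Q b → f (g b) ≡ b) → (∀ a → P a → g (f a) ≡ a) → Σ A P ↔ Σ B Q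
Σ-↔ irrP irrQ f g P⇒Q Q⇒P fg gf = mk↔ₛ′
  (λ (a , p) → f a , P⇒Q a p)
  (λ (b , q) → g b , Q⇒P b q)
  (λ (b , q) → Σ-≡ irrQ (fg b q))
  (λ (a , p) → Σ-≡ irrP (gf a p))

empty↔ : ∀ {A : Set} → ¬ A → Fin 0 ↔ A
empty↔ ¬a = mk↔ₛ′ (λ ()) (λ a → ⊥-elim (¬a a)) (λ a → ⊥-elim (¬a a)) (λ ())

ℕ²-irr : ∀ {a b c d : ℕ} → Irrelevant (a ≡ b × c ≡ d)
ℕ²-irr = ×-irr ≡-irrelevant ≡-irrelevant

ℕ³-irr : ∀ {a b c d e f : ℕ} → Irrelevant (a ≡ b × c ≡ d × e ≡ f)
ℕ³-irr = ×-irr ≡-irrelevant ℕ²-irr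

-- Nonempty binary trees, in the order of a plane forest: left is the forest of the earlier trees,
-- right the forest of the children of the last root.
data BinTree : Set where
  leaf  : BinTree
  left  : BinTree → BinTree
  right : BinTree → BinTree
  both  : BinTree → BinTree → BinTree

binSize : BinTree → ℕ
binSize leaf       = 1
binSize (left t)   = suc (binSize t)
binSize (right t)  = suc (binSize t)
binSize (both l r) = suc (binSize l + binSize r)

stackSize : List BinTree → ℕ
stackSize []      = 0
stackSize (t ∷ s) = binSize t + stackSize s

module _ (ωˡ ωʳ : ℕ → Bool) where

  -- `o` is the number of vertices before the tree in postorder, so its root has label `o` plus its
  -- size.
  binStat : ℕ → BinTree → ℕ
  binStat o leaf       = 1
  binStat o (left t)   = binStat o t + bit (ωˡ (o + suc (binSize t)))
  binStat o (right t)  = binStat o t + bit (ωʳ (o + suc (binSize t)))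
  binStat o (both l r) = binStat o l + binStat (o + binSize l) r

  -- The trees of a stack are listed from the last to the first in postorder.
  stackStat : List BinTree → ℕ
  stackStat []      = 0
  stackStat (t ∷ s) = binStat (stackSize s) t + stackStat s

  -- The term `bit b` is the weight of a vertex that has just been removed from the stack.
  Stack : Bool → ℕ → ℕ → ℕ → Set
  Stack b h n m = Σ (List BinTree) λ s → length s ≡ h × stackSize s ≡ n × bit b + stackStat s ≡ m

  stack-irr : ∀ b h n m s → Irrelevant (length s ≡ h × stackSize s ≡ n × bit b + stackStat s ≡ m)
  stack-irr b h n m s = ℕ³-irr

  private
    lastLabel : ∀ o k n → suc k + o ≡ suc n → o + suc k ≡ suc n
    lastLabel o k n p = trans (+-comm o (suc k)) p

    -- The root of the top tree is the last of all `suc n` vertices, so its label is `suc n`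
    -- whatever the tree is.
    one-child : ∀ (ω : ℕ → Bool) t s n m → suc (binSize t) + stackSize s ≡ suc n →
      (binStat (stackSize s) t + bit (ω (stackSize s + suc (binSize t)))) + stackStat s ≡ m →
      bit (ω (suc n)) + (binStat (stackSize s) t + stackStat s) ≡ m
    one-child ω t s n m size stat = trans
      (trans (rotate (bit (ω (suc n))) (binStat (stackSize s) t) (stackStat s))
        (cong (λ l → (binStat (stackSize s) t + bit (ω l)) + stackStat s) (sym (lastLabel (stackSize s) (binSize t) n size)))) stat
      where
      rotate : ∀ a b c → a + (b + c) ≡ (b + a) + c
      rotate = ℕ-Solver.solve-∀

    one-child⁻ : ∀ (ω : ℕ → Bool) t s n m → binSize t + stackSize s ≡ n →
      bit (ω (suc n)) + (binStat (stackSize s) t + stackStat s) ≡ m →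
      (binStat (stackSize s) t + bit (ω (stackSize s + suc (binSize t)))) + stackStat s ≡ m
    one-child⁻ ω t s n m size stat = trans
      (trans (cong (λ l → (binStat (stackSize s) t + bit (ω l)) + stackStat s) (lastLabel (stackSize s) (binSize t) n (cong suc size)))
        (rotate (bit (ω (suc n))) (binStat (stackSize s) t) (stackStat s))) stat
      where
      rotate : ∀ a b c → (b + a) + c ≡ a + (b + c)
      rotate = ℕ-Solver.solve-∀

    two-sizes : ∀ l r s → binSize l + binSize r + s ≡ binSize r + (binSize l + s)
    two-sizes l r s = comm (binSize l) (binSize r) s
      where
      comm : ∀ a b c → a + b + c ≡ b + (a + c)
      comm = ℕ-Solver.solve-∀

    two-stats : ∀ l r s → binStat (stackSize s) l + binStat (stackSize s + binSize l) r + stackStat s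
      ≡ binStat (binSize l + stackSize s) r + (binStat (stackSize s) l + stackStat s)
    two-stats l r s = trans (comm (binStat (stackSize s) l) (binStat (stackSize s + binSize l) r) (stackStat s))
      (cong (λ o → binStat o r + (binStat (stackSize s) l + stackStat s)) (+-comm (stackSize s) (binSize l)))
      where
      comm : ∀ a b c → a + b + c ≡ b + (a + c)
      comm = ℕ-Solver.solve-∀

  -- Removing the last vertex in postorder.
  peel : ∀ h n m →
    (Stack true h n m ⊎ (Stack (ωˡ (suc n)) (suc h) n m ⊎ (Stack (ωʳ (suc n)) (suc h) n m ⊎ Stack false (suc (suc h)) n m)))
    ↔ Stack false (suc h) (suc n) m
  peel h n m = mk↔ₛ′ to from to∘from from∘to
    where
    to : Stack true h n m ⊎ (Stack (ωˡ (suc n)) (suc h) n m ⊎ (Stack (ωʳ (suc n)) (suc h) n m ⊎ Stack false (suc (suc h)) n m)) → Stack false (suc h) (suc n) m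
    to (inj₁ (s , len , size , stat)) = leaf ∷ s , cong suc len , cong suc size , stat
    to (inj₂ (inj₁ (t ∷ s , len , size , stat))) = left t ∷ s , len , cong suc size , one-child⁻ ωˡ t s n m size stat
    to (inj₂ (inj₂ (inj₁ (t ∷ s , len , size , stat)))) = right t ∷ s , len , cong suc size , one-child⁻ ωʳ t s n m size stat
    -- Removing a root with two subtrees exposes both; the right one is later in postorder and lies
    -- on top.
    to (inj₂ (inj₂ (inj₂ (r ∷ l ∷ s , len , size , stat)))) =
      both l r ∷ s , suc-injective len , cong suc (trans (two-sizes l r (stackSize s)) size) , trans (two-stats l r s) stat
    from : Stack false (suc h) (suc n) m → Stack true h n m ⊎ (Stack (ωˡ (suc n)) (suc h) n m ⊎ (Stack (ωʳ (suc n)) (suc h) n m ⊎ Stack false (suc (suc h)) n m))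
    from (leaf ∷ s , len , size , stat) = inj₁ (s , suc-injective len , suc-injective size , stat)
    from (left t ∷ s , len , size , stat) = inj₂ (inj₁ (t ∷ s , len , suc-injective size , one-child ωˡ t s n m size stat))
    from (right t ∷ s , len , size , stat) = inj₂ (inj₂ (inj₁ (t ∷ s , len , suc-injective size , one-child ωʳ t s n m size stat)))
    from (both l r ∷ s , len , size , stat) = inj₂ (inj₂ (inj₂
      (r ∷ l ∷ s , cong suc len , trans (sym (two-sizes l r (stackSize s))) (suc-injective size) , trans (sym (two-stats l r s)) stat)))
    to∘from : ∀ x → to (from x) ≡ x
    to∘from (leaf ∷ s , _)     = Σ-≡ (stack-irr false (suc h) (suc n) m) refl
    to∘from (left t ∷ s , _)   = Σ-≡ (stack-irr false (suc h) (suc n) m) refl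
    to∘from (right t ∷ s , _)  = Σ-≡ (stack-irr false (suc h) (suc n) m) refl
    to∘from (both l r ∷ s , _) = Σ-≡ (stack-irr false (suc h) (suc n) m) refl
    from∘to : ∀ x → from (to x) ≡ x
    from∘to (inj₁ (s , _))                             = cong inj₁ (Σ-≡ (stack-irr true h n m) refl)
    from∘to (inj₂ (inj₁ (t ∷ s , _)))                  = cong (inj₂ ∘ inj₁) (Σ-≡ (stack-irr (ωˡ (suc n)) (suc h) n m) refl)
    from∘to (inj₂ (inj₂ (inj₁ (t ∷ s , _))))           = cong (inj₂ ∘ inj₂ ∘ inj₁) (Σ-≡ (stack-irr (ωʳ (suc n)) (suc h) n m) refl)
    from∘to (inj₂ (inj₂ (inj₂ (r ∷ l ∷ s , _))))       = cong (inj₂ ∘ inj₂ ∘ inj₂) (Σ-≡ (stack-irr false (suc (suc h)) n m) refl)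

weigh↔ : ∀ {A : Set} {P : A → Set} (stat : A → ℕ) (f : ℕ → ℕ) → (∀ a → Irrelevant (P a)) →
  (∀ m → Fin (f m) ↔ Σ A λ a → P a × stat a ≡ m) →
  ∀ b m → Fin (weigh b f m) ↔ Σ A λ a → P a × bit b + stat a ≡ m
weigh↔ stat f irr f↔ false m       = f↔ m
weigh↔ stat f irr f↔ true  zero    = empty↔ λ { (_ , _ , ()) }
weigh↔ stat f irr f↔ true  (suc m) = ↔-trans (f↔ m)
  (Σ-↔ (λ a → ×-irr (irr a) ≡-irrelevant) (λ a → ×-irr (irr a) ≡-irrelevant) (λ a → a) (λ a → a)
    (λ _ (p , q) → p , cong suc q) (λ _ (p , q) → p , suc-injective q) (λ _ _ → refl) (λ _ _ → refl))

module _ (ωˡ ωʳ : ℕ → Bool) where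

  assoc↔ : ∀ b h n m → (Σ (List BinTree) λ s → (length s ≡ h × stackSize s ≡ n) × bit b + stackStat ωˡ ωʳ s ≡ m) ↔ Stack ωˡ ωʳ b h n m
  assoc↔ b h n m = mk↔ₛ′ (λ (s , (p , q) , r) → s , p , q , r) (λ (s , p , q , r) → s , (p , q) , r) (λ _ → refl) (λ _ → refl)

  -- The summands of `pathCount` are the cases of `peel`.
  stacks↔ : ∀ n h m → Fin (pathCount ωˡ ωʳ n h m) ↔ Stack ωˡ ωʳ false h n m
  weighed↔ : ∀ b n h m → Fin (weigh b (pathCount ωˡ ωʳ n h) m) ↔ Stack ωˡ ωʳ b h n m

  weighed↔ b n h m = ↔-trans
    (weigh↔ (stackStat ωˡ ωʳ) (pathCount ωˡ ωʳ n h) (λ _ → ℕ²-irr) (λ m → ↔-trans (stacks↔ n h m) (↔-sym (assoc↔ false h n m))) b m)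
    (assoc↔ b h n m)

  stacks↔ zero zero zero = mk↔ₛ′ (λ _ → [] , refl , refl , refl) (λ _ → zero)
    (λ { ([] , _) → Σ-≡ (stack-irr ωˡ ωʳ false 0 0 0) refl }) (λ { zero → refl })
  stacks↔ zero zero (suc m) = empty↔ λ { ([] , _ , _ , ()) }
  stacks↔ zero (suc h) m = empty↔ λ { (leaf ∷ _ , _ , () , _) ; (left _ ∷ _ , _ , () , _) ; (right _ ∷ _ , _ , () , _) ; (both _ _ ∷ _ , _ , () , _) }
  stacks↔ (suc n) zero m = empty↔ λ { ([] , _ , () , _) }
  stacks↔ (suc n) (suc h) m = ↔-trans
    (↔-trans +↔⊎ (weighed↔ true n h m ⊎-↔ ↔-trans +↔⊎ (weighed↔ (ωˡ (suc n)) n (suc h) m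
      ⊎-↔ ↔-trans +↔⊎ (weighed↔ (ωʳ (suc n)) n (suc h) m ⊎-↔ stacks↔ n (suc (suc h)) m))))
    (peel ωˡ ωʳ h n m)

forest : BinTree → List Tree
forest leaf       = node [] ∷ []
forest (left t)   = forest t ++ node [] ∷ []
forest (right t)  = node (forest t) ∷ []
forest (both l r) = forest l ++ node (forest r) ∷ []

forest′ : Maybe BinTree → List Tree
forest′ = maybe′ forest []

attach : Maybe BinTree → Maybe BinTree → BinTree
attach nothing  nothing  = leaf
attach (just l) nothing  = left l
attach nothing  (just r) = right r
attach (just l) (just r) = both l r

-- The accumulator is the binary tree of the trees read so far, which becomes the left subtree of
-- the next root.
parse : Maybe BinTree → List Tree → Maybe BinTree
parse acc []               = acc
parse acc (node ts ∷ rest) = parse (just (attach acc (parse nothing ts))) rest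

forest-attach : ∀ l r → forest (attach l r) ≡ forest′ l ++ node (forest′ r) ∷ []
forest-attach nothing  nothing  = refl
forest-attach (just l) nothing  = refl
forest-attach nothing  (just r) = refl
forest-attach (just l) (just r) = refl

forest-parse : ∀ acc ts → forest′ (parse acc ts) ≡ forest′ acc ++ ts
forest-parse acc []               = sym (++-identityʳ (forest′ acc))
forest-parse acc (node ts ∷ rest) = begin
  forest′ (parse (just (attach acc (parse nothing ts))) rest)    ≡⟨ forest-parse (just (attach acc (parse nothing ts))) rest ⟩
  forest (attach acc (parse nothing ts)) ++ rest                 ≡⟨ cong (_++ rest) (forest-attach acc (parse nothing ts)) ⟩
  (forest′ acc ++ node (forest′ (parse nothing ts)) ∷ []) ++ rest ≡⟨ ++-assoc (forest′ acc) _ rest ⟩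
  forest′ acc ++ node (forest′ (parse nothing ts)) ∷ rest        ≡⟨ cong (λ us → forest′ acc ++ node us ∷ rest) (forest-parse nothing ts) ⟩
  forest′ acc ++ node ts ∷ rest                                  ∎
  where open ≡-Reasoning

parse-++ : ∀ acc ts us → parse acc (ts ++ us) ≡ parse (parse acc ts) us
parse-++ acc []               us = refl
parse-++ acc (node ts ∷ rest) us = parse-++ (just (attach acc (parse nothing ts))) rest us

parse-forest : ∀ t → parse nothing (forest t) ≡ just t
parse-forest leaf       = refl
parse-forest (left t)   rewrite parse-++ nothing (forest t) (node [] ∷ []) | parse-forest t = refl
parse-forest (right t)  rewrite parse-forest t = refl
parse-forest (both l r) rewrite parse-++ nothing (forest l) (node (forest r) ∷ []) | parse-forest l | parse-forest r = refl

sizes-++ : ∀ ts us → sizes (ts ++ us) ≡ sizes ts + sizes us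
sizes-++ []       us = refl
sizes-++ (t ∷ ts) us = trans (cong (λ x → size t + x) (sizes-++ ts us)) (sym (+-assoc (size t) _ _))

sizes-∷ʳ : ∀ ts us → sizes (ts ++ node us ∷ []) ≡ suc (sizes ts + sizes us)
sizes-∷ʳ ts us = trans (sizes-++ ts (node us ∷ [])) (trans (+-suc (sizes ts) _) (cong (λ x → suc (sizes ts + x)) (+-identityʳ (sizes us))))

sizes-forest : ∀ t → sizes (forest t) ≡ binSize t
sizes-forest leaf       = refl
sizes-forest (left t)   = trans (sizes-∷ʳ (forest t) []) (cong suc (trans (+-identityʳ _) (sizes-forest t)))
sizes-forest (right t)  = cong suc (trans (+-identityʳ _) (sizes-forest t))
sizes-forest (both l r) = trans (sizes-∷ʳ (forest l) (forest r)) (cong suc (cong₂ _+_ (sizes-forest l) (sizes-forest r)))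

isNil-∷ʳ : ∀ {A : Set} (xs : List A) x → isNil (xs ++ x ∷ []) ≡ false
isNil-∷ʳ []      x = refl
isNil-∷ʳ (_ ∷ _) x = refl

isNil-forest : ∀ t → isNil (forest t) ≡ false
isNil-forest leaf       = refl
isNil-forest (left t)   = isNil-∷ʳ (forest t) (node [])
isNil-forest (right t)  = refl
isNil-forest (both l r) = isNil-∷ʳ (forest l) (node (forest r))

count : ∀ {A : Set} → (A → Bool) → List A → ℕ
count p []       = 0
count p (x ∷ xs) = bit (p x) + count p xs

count-++ : ∀ {A : Set} (p : A → Bool) xs ys → count p (xs ++ ys) ≡ count p xs + count p ys
count-++ p []       ys = refl
count-++ p (x ∷ xs) ys = trans (cong (λ c → bit (p x) + c) (count-++ p xs ys)) (sym (+-assoc (bit (p x)) _ _))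

length-filter≡count : ∀ {A : Set} (p : A → Bool) xs → length (filter (λ x → p x Bool.≟ true) xs) ≡ count p xs
length-filter≡count p []       = refl
length-filter≡count p (x ∷ xs) with p x
... | true  = cong suc (length-filter≡count p xs)
... | false = length-filter≡count p xs

-- Since `ts` is not empty, it contains the leftmost child, and no tree of `us` is one.
kids-∷ʳ : ∀ pr o ts us → isNil ts ≡ false →
  kids pr true o (ts ++ us) ≡ kids pr true o ts ++ kids pr false (o + sizes ts) us
kids-∷ʳ pr o (t ∷ ts) us _ = trans (cong (verts pr true o t ++_) (later (o + size t) ts))
  (trans (sym (++-assoc (verts pr true o t) _ _)) (cong (λ x → kids pr true o (t ∷ ts) ++ kids pr false x us) (+-assoc o (size t) (sizes ts))))
  where
  later : ∀ o ts → kids pr false o (ts ++ us) ≡ kids pr false o ts ++ kids pr false (o + sizes ts) us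
  later o []       = cong (λ x → kids pr false x us) (sym (+-identityʳ o))
  later o (t ∷ ts) = trans (cong (verts pr false o t ++_) (later (o + size t) ts))
    (trans (sym (++-assoc (verts pr false o t) _ _)) (cong (λ x → kids pr false o (t ∷ ts) ++ kids pr false x us) (+-assoc o (size t) (sizes ts))))

count-last : ∀ (p : VInfo → Bool) pr lm o ts →
  count p (kids pr lm o (node ts ∷ [])) ≡ count p (kids false true o ts) + bit (p (vinfo (isNil ts) lm pr (o + suc (sizes ts))))
count-last p pr lm o ts = trans (cong (count p) (++-identityʳ (verts pr lm o (node ts))))
  (trans (count-++ p (kids false true o ts) _) (cong (λ x → count p (kids false true o ts) + x) (+-identityʳ _)))

-- Leftmost leaves have no binary subtree, other leaves only a left one, leftmost inner vertices
-- only a right one, and other inner vertices both. `leaf-first` concerns label 1 alone: a leaf that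
-- is the leftmost child of the root comes first in postorder.
record MatchesWeights (p : VInfo → Bool) (ωˡ ωʳ : ℕ → Bool) : Set where
  field
    leaf-leftmost    : ∀ l → p (vinfo true true false l) ≡ true
    leaf-first       : p (vinfo true true true 1) ≡ true
    leaf-other       : ∀ pr l → p (vinfo true false pr l) ≡ ωˡ l
    inner-leftmost   : ∀ pr l → p (vinfo false true pr l) ≡ ωʳ l
    inner-other      : ∀ pr l → p (vinfo false false pr l) ≡ false

module _ {p : VInfo → Bool} {ωˡ ωʳ : ℕ → Bool} (matches : MatchesWeights p ωˡ ωʳ) where
  open MatchesWeights matches

  -- The disjunction records that labels start at 0 in the forest below the root, so that
  -- `leaf-first` applies to its leftmost leaf.
  count-forest : ∀ pr o t → pr ≡ false ⊎ o ≡ 0 → count p (kids pr true o (forest t)) ≡ binStat ωˡ ωʳ o t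
  count-forest pr o leaf start = trans (count-last p pr true o []) (cong bit (first pr o start))
    where
    first : ∀ pr o → pr ≡ false ⊎ o ≡ 0 → p (vinfo true true pr (o + 1)) ≡ true
    first true  .0 (inj₂ refl) = leaf-first
    first false o  _           = leaf-leftmost (o + 1)
  count-forest pr o (left t) start = begin
    count p (kids pr true o (forest t ++ node [] ∷ []))
      ≡⟨ cong (count p) (kids-∷ʳ pr o (forest t) (node [] ∷ []) (isNil-forest t)) ⟩
    count p (kids pr true o (forest t) ++ kids pr false (o + sizes (forest t)) (node [] ∷ []))
      ≡⟨ count-++ p (kids pr true o (forest t)) _ ⟩
    count p (kids pr true o (forest t)) + count p (kids pr false (o + sizes (forest t)) (node [] ∷ []))
      ≡⟨ cong₂ _+_ (count-forest pr o t start) (trans (count-last p pr false (o + sizes (forest t)) []) (cong bit (leaf-other pr _))) ⟩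
    binStat ωˡ ωʳ o t + bit (ωˡ (o + sizes (forest t) + 1))
      ≡⟨ cong (λ l → binStat ωˡ ωʳ o t + bit (ωˡ l)) (trans (+-assoc o _ 1) (cong (λ x → o + x) (trans (+-comm _ 1) (cong suc (sizes-forest t))))) ⟩
    binStat ωˡ ωʳ o (left t) ∎
    where open ≡-Reasoning
  count-forest pr o (right t) start = trans (count-last p pr true o (forest t))
    (cong₂ _+_ (count-forest false o t (inj₁ refl))
      (cong bit (trans (cong₂ (λ b l → p (vinfo b true pr (o + suc l))) (isNil-forest t) (sizes-forest t)) (inner-leftmost pr _))))
  count-forest pr o (both l r) start = begin
    count p (kids pr true o (forest l ++ node (forest r) ∷ []))
      ≡⟨ cong (count p) (kids-∷ʳ pr o (forest l) (node (forest r) ∷ []) (isNil-forest l)) ⟩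
    count p (kids pr true o (forest l) ++ kids pr false (o + sizes (forest l)) (node (forest r) ∷ []))
      ≡⟨ count-++ p (kids pr true o (forest l)) _ ⟩
    count p (kids pr true o (forest l)) + count p (kids pr false (o + sizes (forest l)) (node (forest r) ∷ []))
      ≡⟨ cong₂ _+_ (count-forest pr o l start) (trans (cong (λ x → count p (kids pr false (o + x) (node (forest r) ∷ []))) (sizes-forest l))
           (trans (count-last p pr false (o + binSize l) (forest r)) (cong₂ _+_ (count-forest false (o + binSize l) r (inj₁ refl))
             (cong bit (trans (cong (λ b → p (vinfo b false pr (o + binSize l + suc (sizes (forest r))))) (isNil-forest r)) (inner-other pr _)))))) ⟩
    binStat ωˡ ωʳ o l + (binStat ωˡ ωʳ (o + binSize l) r + 0)
      ≡⟨ cong (λ x → binStat ωˡ ωʳ o l + x) (+-identityʳ _) ⟩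
    binStat ωˡ ωʳ o (both l r) ∎
    where open ≡-Reasoning

  -- A stack of height 1 is a single binary tree, and this is the same as a nonempty forest.
  forests↔ : ∀ n m → Fin (pathCount ωˡ ωʳ (suc n) 1 m) ↔ Σ (List Tree) λ ts → sizes ts ≡ suc n × count p (kids true true 0 ts) ≡ m
  forests↔ n m = ↔-trans (stacks↔ ωˡ ωʳ (suc n) 1 m)
    (Σ-↔ (stack-irr ωˡ ωʳ false 1 (suc n) m) (λ _ → ℕ²-irr) unstack (λ ts → stack (parse nothing ts)) sound
      (λ ts (size , stat) → complete ts (parse nothing ts) (forest-parse nothing ts) size stat)
      (λ ts (size , _) → unstack-stack (parse nothing ts) (forest-parse nothing ts))
      stack-unstack)
    where
    stack : Maybe BinTree → List BinTree
    stack = maybe′ [_] []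
    unstack : List BinTree → List Tree
    unstack []      = []
    unstack (t ∷ _) = forest t
    sound : ∀ s → length s ≡ 1 × stackSize s ≡ suc n × stackStat ωˡ ωʳ s ≡ m → sizes (unstack s) ≡ suc n × count p (kids true true 0 (unstack s)) ≡ m
    sound (t ∷ []) (_ , size , stat) =
      trans (sizes-forest t) (trans (sym (+-identityʳ _)) size) ,
      trans (count-forest true 0 t (inj₂ refl)) (trans (sym (+-identityʳ _)) stat)
    complete : ∀ ts x → forest′ x ≡ ts → sizes ts ≡ suc n → count p (kids true true 0 ts) ≡ m →
      length (stack x) ≡ 1 × stackSize (stack x) ≡ suc n × stackStat ωˡ ωʳ (stack x) ≡ m
    complete .(forest t) (just t) refl size stat =
      refl , trans (+-identityʳ _) (trans (sym (sizes-forest t)) size) ,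
      trans (+-identityʳ _) (trans (sym (count-forest true 0 t (inj₂ refl))) stat)
    unstack-stack : ∀ x {ts} → forest′ x ≡ ts → unstack (stack x) ≡ ts
    unstack-stack nothing  p = p
    unstack-stack (just t) p = p
    stack-unstack : ∀ s → length s ≡ 1 × stackSize s ≡ suc n × stackStat ωˡ ωʳ s ≡ m → stack (parse nothing (unstack s)) ≡ s
    stack-unstack (t ∷ []) _ = cong stack (parse-forest t)

-- The case i ≥ 1

≤ᵇ-true : ∀ {m n} → m ≤ n → (m ≤ᵇ n) ≡ true
≤ᵇ-true {m} {n} m≤n with m ≤ᵇ n | ≤⇒≤ᵇ m≤n
... | true | _ = refl

≤ᵇ-false : ∀ {m n} → n < m → (m ≤ᵇ n) ≡ false
≤ᵇ-false {m} {n} n<m with m ≤ᵇ n | ≤ᵇ⇒≤ m n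
... | false | _ = refl
... | true  | f = ⊥-elim (<⇒≱ n<m (f tt))

slopeList-replicate : ∀ ωˡ ωʳ δ r n → (∀ l → n < l → l ≤ r + n → bit (ωˡ l) + bit (ωʳ l) ≡ δ) →
  slopeList ωˡ ωʳ (r + n) ≡ replicate r δ ++ slopeList ωˡ ωʳ n
slopeList-replicate ωˡ ωʳ δ zero    n _     = refl
slopeList-replicate ωˡ ωʳ δ (suc r) n slope =
  cong₂ _∷_ (slope (suc (r + n)) (s≤s (m≤n+m n r)) ≤-refl)
            (slopeList-replicate ωˡ ωʳ δ r n (λ l n<l l≤ → slope l n<l (m≤n⇒m≤1+n l≤)))

tree↔ : ∀ n (f : List Tree → ℕ) (g : Tree → ℕ) m → (∀ ts → sizes ts ≡ n → f ts ≡ g (node ts)) →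
  (Σ (List Tree) λ ts → sizes ts ≡ n × f ts ≡ m) ↔ (Σ Tree λ t → size t ≡ suc n × g t ≡ m)
tree↔ n f g m f≡g = Σ-↔ (λ _ → ℕ²-irr) (λ _ → ℕ²-irr) node (λ { (node ts) → ts })
  (λ ts (s , c) → cong suc s , trans (sym (f≡g ts s)) c)
  (λ { (node ts) (s , c) → suc-injective s , trans (f≡g ts (suc-injective s)) c })
  (λ { (node ts) _ → refl }) (λ _ _ → refl)

countSpecial≡ : ∀ i j ts d → suc (sizes ts) ≡ d → count (counted d i j) (kids true true 0 ts) ≡ countSpecial i j (node ts)
countSpecial≡ i j ts d refl = sym (length-filter≡count (counted d i j) (kids true true 0 ts))

module _ (d i j : ℕ) where

  leftWeight rightWeight : ℕ → Bool
  leftWeight  l = (l ≤ᵇ i) ∨ (d ∸ j ≤ᵇ l)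
  rightWeight l = d ∸ j ≤ᵇ l

  -- The bound on i enters through `leaf-first`: the leaf with label 1 is of type (1) and has to
  -- count.
  counted-matches : 1 ≤ i → MatchesWeights (counted d i j) leftWeight rightWeight
  counted-matches (s≤s _) = record
    { leaf-leftmost  = λ _ → refl
    ; leaf-first     = refl
    ; leaf-other     = λ _ l → Bool.∨-identityʳ (leftWeight l)
    ; inner-leftmost = λ _ _ → refl
    ; inner-other    = λ _ _ → refl
    }

-- Labels below the root run from 1 to d - 1. As i + j ≤ d - 1, the ranges up to i and from d - j on
-- are disjoint, with `b` labels between them.
slopeList≡slopes : ∀ a b c → let n = a + (b + suc c); d = suc n in
  slopeList (leftWeight d (suc c) a) (rightWeight d (suc c) a) n ≡ slopes a b c
slopeList≡slopes a b c =
  trans (slopeList-replicate ωˡ ωʳ 2 a (b + suc c) last)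
  (cong (replicate a 2 ++_) (trans (slopeList-replicate ωˡ ωʳ 0 b (suc c) mid)
  (cong (replicate b 0 ++_) (trans (cong (slopeList ωˡ ωʳ) (sym (+-identityʳ (suc c))))
  (trans (slopeList-replicate ωˡ ωʳ 1 (suc c) 0 first) (++-identityʳ _))))))
  where
  d = suc (a + (b + suc c))
  ωˡ = leftWeight d (suc c) a
  ωʳ = rightWeight d (suc c) a
  d∸a : d ∸ a ≡ suc (b + suc c)
  d∸a = trans (cong (_∸ a) (sym (+-suc a (b + suc c)))) (m+n∸m≡n a (suc (b + suc c)))
  slope : ∀ l {x y} → (l ≤ᵇ suc c) ≡ x → (suc (b + suc c) ≤ᵇ l) ≡ y → bit (ωˡ l) + bit (ωʳ l) ≡ bit (x ∨ y) + bit y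
  slope l refl refl = cong (λ t → bit ((l ≤ᵇ suc c) ∨ (t ≤ᵇ l)) + bit (t ≤ᵇ l)) d∸a
  last : ∀ l → b + suc c < l → l ≤ a + (b + suc c) → bit (ωˡ l) + bit (ωʳ l) ≡ 2
  last l n<l _ = slope l (≤ᵇ-false (≤-trans (s≤s (m≤n+m (suc c) b)) n<l)) (≤ᵇ-true n<l)
  mid : ∀ l → suc c < l → l ≤ b + suc c → bit (ωˡ l) + bit (ωʳ l) ≡ 0
  mid l c<l l≤ = slope l (≤ᵇ-false c<l) (≤ᵇ-false (s≤s l≤))
  first : ∀ l → 0 < l → l ≤ suc c + 0 → bit (ωˡ l) + bit (ωʳ l) ≡ 1
  first l _ l≤ = slope l (≤ᵇ-true l≤c) (≤ᵇ-false (s≤s (≤-trans l≤c (m≤n+m (suc c) b))))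
    where l≤c = ≤-trans l≤ (≤-reflexive (+-identityʳ (suc c)))

-- The coefficients of x^(-d) f_d(i, j, x) in powers of z = 1/x - 1.
fSequence : ℕ → ℕ → ℕ → ℕ → ℕ
fSequence d i j k = catalan (d ∸ 1 ∸ k) * innerSum d i j k

fSequence≡motzkin : ∀ a b c k → let n = a + (b + suc c) in k < suc n → fSequence (suc n) (suc c) a k ≡ motzkin (slopes a b c) 1 k
fSequence≡motzkin a b c k (s≤s k≤n) = sym (trans
  (motzkin-slopes a b c k (n ∸ k) (m+[n∸m]≡n k≤n))
  (cong (catalan (n ∸ k) *_) (trans (cong (λ N → binomialSum a (diagBinom N k)) upper) (sym (innerSum≡ (suc n) (suc c) a k (s≤s k≤n))))))
  where
  n = a + (b + suc c)
  upper : a + ((n ∸ k) + suc c) ≡ n + suc c + a ∸ k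
  upper = trans (+-comm a _) (trans (cong (_+ a) (sym (+-∸-comm (suc c) k≤n))) (sym (+-∸-comm a (≤-trans k≤n (m≤m+n n (suc c))))))

theorem-positive : ∀ a b c m → let d = suc (a + (b + suc c)) in m ≤ d →
  ∃[ N ] ((coeff (fPoly d (suc c) a) (d ∸ m) ≡ + N)
    × (Fin N ↔ Σ Tree (λ t → size t ≡ d × countSpecial (suc c) a t ≡ m)))
-- The forest below the root is one binary tree with d - 1 vertices, hence the height 1.
theorem-positive a b c m m≤d = pathCount ωˡ ωʳ n 1 m , coefficient , bijection
  where
  n = a + (b + suc c)
  d = suc n
  ωˡ = leftWeight d (suc c) a
  ωʳ = rightWeight d (suc c) a
  coefficient : coeff (fPoly d (suc c) a) (d ∸ m) ≡ + pathCount ωˡ ωʳ n 1 m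
  coefficient = trans (coeff-fPoly d (suc c) a m m≤d) (sym (trans (pathCount≡ ωˡ ωʳ n 1 m d ≤-refl)
    (substitute-cong d (λ k k<d → trans (cong (λ δs → motzkin δs 1 k) (slopeList≡slopes a b c)) (sym (fSequence≡motzkin a b c k k<d))) m)))
  n≡suc : n ≡ suc (a + (b + c))
  n≡suc = trans (cong (λ x → a + x) (+-suc b c)) (+-suc a (b + c))
  bijection : Fin (pathCount ωˡ ωʳ n 1 m) ↔ Σ Tree (λ t → size t ≡ d × countSpecial (suc c) a t ≡ m)
  bijection = ↔-trans
    (subst (λ n → Fin (pathCount ωˡ ωʳ n 1 m) ↔ Σ (List Tree) (λ ts → sizes ts ≡ n × count (counted d (suc c) a) (kids true true 0 ts) ≡ m))
      (sym n≡suc) (forests↔ (counted-matches d (suc c) a (s≤s z≤n)) (a + (b + c)) m))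
    (tree↔ n _ (countSpecial (suc c) a) m (λ ts size → countSpecial≡ (suc c) a ts d (cong suc size)))

-- The case i = j = 0

mutual
  -- Label-free forms of the statistic: `rootedLeaves` treats the forest as the children of a
  -- non-root vertex, `innerLeaves` as trees whose own roots do not count.
  rootedLeaves : List Tree → ℕ
  rootedLeaves []                     = 0
  rootedLeaves (node [] ∷ rest)       = suc (innerLeaves rest)
  rootedLeaves (node (t ∷ ts) ∷ rest) = rootedLeaves (t ∷ ts) + innerLeaves rest

  innerLeaves : List Tree → ℕ
  innerLeaves []               = 0
  innerLeaves (node ts ∷ rest) = rootedLeaves ts + innerLeaves rest

leaves : Bool → List Tree → ℕ
leaves true  = rootedLeaves
leaves false = innerLeaves

-- u tells whether a leaf that is the leftmost child of the root counts.
CountsLeftmostLeaves : Bool → ℕ → (VInfo → Bool) → Set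
CountsLeftmostLeaves u n p = ∀ lf lm pr l → 0 < l → l ≤ n → p (vinfo lf lm pr l) ≡ lf ∧ lm ∧ (not pr ∨ u)

-- The flag `lm ∧ (not pr ∨ u)` tells whether a leaf at the front of the current forest counts. It
-- is true below every non-root vertex and false for all later trees, so one induction serves both
-- values of `u`.
count-leaves : ∀ {u n p} → CountsLeftmostLeaves u n p → ∀ pr lm o ts → o + sizes ts ≤ n →
  count p (kids pr lm o ts) ≡ leaves (lm ∧ (not pr ∨ u)) ts
count-leaves {u} spec pr lm o [] _ with lm ∧ (not pr ∨ u)
... | true  = refl
... | false = refl
count-leaves {u} {n} {p} spec pr lm o (node ts ∷ rest) bound = begin
  count p ((kids false true o ts ++ [ v ]) ++ kids pr false (o + suc (sizes ts)) rest)
    ≡⟨ count-++ p (kids false true o ts ++ [ v ]) _ ⟩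
  count p (kids false true o ts ++ [ v ]) + count p (kids pr false (o + suc (sizes ts)) rest)
    ≡⟨ cong₂ _+_ (count-++ p (kids false true o ts) [ v ])
         (count-leaves spec pr false (o + suc (sizes ts)) rest (≤-trans (≤-reflexive (+-assoc o _ _)) bound)) ⟩
  count p (kids false true o ts) + (bit (p v) + 0) + innerLeaves rest
    ≡⟨ cong₂ (λ x y → x + y + innerLeaves rest) (count-leaves spec false true o ts (≤-trans (+-monoʳ-≤ o (n≤1+n (sizes ts))) inside))
         (trans (+-identityʳ _) (cong bit (spec (isNil ts) lm pr _ (m<n⇒0<n (m<m+n o (s≤s z≤n))) inside))) ⟩
  rootedLeaves ts + bit (isNil ts ∧ lm ∧ (not pr ∨ u)) + innerLeaves rest
    ≡⟨ first ts (lm ∧ (not pr ∨ u)) ⟩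
  leaves (lm ∧ (not pr ∨ u)) (node ts ∷ rest) ∎
  where
  open ≡-Reasoning
  v = vinfo (isNil ts) lm pr (o + suc (sizes ts))
  inside : o + suc (sizes ts) ≤ n
  inside = ≤-trans (+-monoʳ-≤ o (m≤m+n (suc (sizes ts)) (sizes rest))) bound
  first : ∀ ts b → rootedLeaves ts + bit (isNil ts ∧ b) + innerLeaves rest ≡ leaves b (node ts ∷ rest)
  first []       true  = refl
  first []       false = refl
  first (t ∷ ts) true  = cong (_+ innerLeaves rest) (+-identityʳ _)
  first (t ∷ ts) false = cong (_+ innerLeaves rest) (+-identityʳ _)

-- The label conditions become l ≤ 0 and l ≥ d, which no vertex other than the root meets.
counted₀₀-leaves : ∀ n → CountsLeftmostLeaves false n (counted (suc n) 0 0)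
counted₀₀-leaves n lf lm pr (suc l) _ l≤n rewrite ≤ᵇ-false (s≤s l≤n) = table lf lm pr
  where
  table : ∀ lf lm pr → type0 (vinfo lf lm pr (suc l)) ∨ type1 (vinfo lf lm pr (suc l)) ∧ false ∨ type2 (vinfo lf lm pr (suc l)) ∧ false
        ≡ lf ∧ lm ∧ (not pr ∨ false)
  table true  true  true  = refl
  table true  true  false = refl
  table true  false _     = refl
  table false true  _     = refl
  table false false _     = refl

leftmostLeaf : VInfo → Bool
leftmostLeaf v = isLeaf v ∧ isLeftmost v

leftmostLeaf-leaves : ∀ n → CountsLeftmostLeaves true n leftmostLeaf
leftmostLeaf-leaves n true  true  pr l _ _ = sym (Bool.∨-zeroʳ (not pr))
leftmostLeaf-leaves n true  false pr l _ _ = refl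
leftmostLeaf-leaves n false lm    pr l _ _ = refl

leftmostLeaf-matches : MatchesWeights leftmostLeaf (λ _ → false) (λ _ → false)
leftmostLeaf-matches = record
  { leaf-leftmost  = λ _ → refl
  ; leaf-first     = refl
  ; leaf-other     = λ _ _ → refl
  ; inner-leftmost = λ _ _ → refl
  ; inner-other    = λ _ _ → refl
  }

Forests : Bool → ℕ → ℕ → Set
Forests b n m = Σ (List Tree) λ ts → sizes ts ≡ n × leaves b ts ≡ m

-- The paths with δ = 0 throughout. As label 1 is never a level step, they also describe i = 1, j =
-- 0.
rootedCount : ℕ → ℕ → ℕ
rootedCount n = pathCount (λ _ → false) (λ _ → false) (suc n) 1

rooted↔ : ∀ n m → Fin (rootedCount n m) ↔ Forests true (suc n) m
rooted↔ n m = ↔-trans (forests↔ leftmostLeaf-matches n m)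
  (Σ-↔ (λ _ → ℕ²-irr) (λ _ → ℕ²-irr) (λ ts → ts) (λ ts → ts)
    (λ ts (s , c) → s , trans (sym (same ts)) c) (λ ts (s , c) → s , trans (same ts) c) (λ _ _ → refl) (λ _ _ → refl))
  where
  same : ∀ ts → count leftmostLeaf (kids true true 0 ts) ≡ rootedLeaves ts
  same ts = count-leaves (leftmostLeaf-leaves (sizes ts)) true true 0 ts ≤-refl

-- Forests whose first tree is not a single vertex.
Branched : ℕ → ℕ → Set
Branched n m = Σ (Tree × List Tree × List Tree) λ (t , ts , rest) →
  sizes (t ∷ ts) + sizes rest ≡ n × rootedLeaves (t ∷ ts) + innerLeaves rest ≡ m

-- The branched part is the same for both values of `b`, so it can be eliminated between them.
forests-split : ∀ b n m →
  (Branched n m ⊎ (Σ (List Tree) λ ts → sizes ts ≡ n × bit b + innerLeaves ts ≡ m)) ↔ Forests b (suc n) m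
forests-split b n m = mk↔ₛ′ (to b) (from b) (to∘from b) (from∘to b)
  where
  Rest : Bool → Set
  Rest b = Σ (List Tree) λ ts → sizes ts ≡ n × bit b + innerLeaves ts ≡ m
  to : ∀ b → Branched n m ⊎ Rest b → Forests b (suc n) m
  to true  (inj₁ ((t , ts , rest) , s , c)) = node (t ∷ ts) ∷ rest , cong suc s , c
  to false (inj₁ ((t , ts , rest) , s , c)) = node (t ∷ ts) ∷ rest , cong suc s , c
  to true  (inj₂ (rest , s , c))            = node [] ∷ rest , cong suc s , c
  to false (inj₂ (rest , s , c))            = node [] ∷ rest , cong suc s , c
  from : ∀ b → Forests b (suc n) m → Branched n m ⊎ Rest b
  from true  (node [] ∷ rest       , s , c) = inj₂ (rest , suc-injective s , c)
  from false (node [] ∷ rest       , s , c) = inj₂ (rest , suc-injective s , c)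
  from true  (node (t ∷ ts) ∷ rest , s , c) = inj₁ ((t , ts , rest) , suc-injective s , c)
  from false (node (t ∷ ts) ∷ rest , s , c) = inj₁ ((t , ts , rest) , suc-injective s , c)
  to∘from : ∀ b x → to b (from b x) ≡ x
  to∘from true  (node [] ∷ rest       , _) = Σ-≡ (λ _ → ℕ²-irr) refl
  to∘from false (node [] ∷ rest       , _) = Σ-≡ (λ _ → ℕ²-irr) refl
  to∘from true  (node (t ∷ ts) ∷ rest , _) = Σ-≡ (λ _ → ℕ²-irr) refl
  to∘from false (node (t ∷ ts) ∷ rest , _) = Σ-≡ (λ _ → ℕ²-irr) refl
  from∘to : ∀ b x → from b (to b x) ≡ x
  from∘to true  (inj₁ _) = cong inj₁ (Σ-≡ (λ _ → ℕ²-irr) refl)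
  from∘to false (inj₁ _) = cong inj₁ (Σ-≡ (λ _ → ℕ²-irr) refl)
  from∘to true  (inj₂ _) = cong inj₂ (Σ-≡ (λ _ → ℕ²-irr) refl)
  from∘to false (inj₂ _) = cong inj₂ (Σ-≡ (λ _ → ℕ²-irr) refl)

-- Cancelling a summand of a finite set

countFin : ∀ n → (Fin n → Bool) → ℕ
countFin zero    P = 0
countFin (suc n) P = bit (P zero) + countFin n (P ∘ suc)

countFin↔ : ∀ n P → Fin (countFin n P) ↔ Σ (Fin n) λ k → P k ≡ true
countFin↔ zero    P = empty↔ λ ()
countFin↔ (suc n) P = ↔-trans (↔-trans +↔⊎ (bit↔ (P zero) ⊎-↔ countFin↔ n (P ∘ suc))) (mk↔ₛ′ to from to∘from from∘to)
  where
  bit↔ : ∀ b → Fin (bit b) ↔ (b ≡ true)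
  bit↔ true  = mk↔ₛ′ (λ _ → refl) (λ _ → zero) (λ { refl → refl }) (λ { zero → refl })
  bit↔ false = empty↔ λ ()
  to : P zero ≡ true ⊎ Σ (Fin n) (λ k → P (suc k) ≡ true) → Σ (Fin (suc n)) λ k → P k ≡ true
  to (inj₁ p)       = zero , p
  to (inj₂ (k , p)) = suc k , p
  from : Σ (Fin (suc n)) (λ k → P k ≡ true) → P zero ≡ true ⊎ Σ (Fin n) (λ k → P (suc k) ≡ true)
  from (zero  , p) = inj₁ p
  from (suc k , p) = inj₂ (k , p)
  to∘from : ∀ x → to (from x) ≡ x
  to∘from (zero  , p) = refl
  to∘from (suc k , p) = refl
  from∘to : ∀ x → from (to x) ≡ x
  from∘to (inj₁ p)       = refl
  from∘to (inj₂ (k , p)) = refl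

isInj₁ : ∀ {X Y : Set} → X ⊎ Y → Bool
isInj₁ (inj₁ _) = true
isInj₁ (inj₂ _) = false

summand↔ : ∀ {X Y : Set} {n} (f : Fin n ↔ (X ⊎ Y)) → Fin (countFin n (isInj₁ ∘ Inverse.to f)) ↔ X
summand↔ {X} {Y} {n} f = ↔-trans (countFin↔ n (isInj₁ ∘ f.to)) (mk↔ₛ′ back embed back∘embed embed∘back)
  where
  module f = Inverse f
  fromInj₁ : (s : X ⊎ Y) → isInj₁ s ≡ true → X
  fromInj₁ (inj₁ x) _ = x
  inj₁-fromInj₁ : ∀ s p → inj₁ (fromInj₁ s p) ≡ s
  inj₁-fromInj₁ (inj₁ x) _ = refl
  back : Σ (Fin n) (λ k → isInj₁ (f.to k) ≡ true) → X
  back (k , p) = fromInj₁ (f.to k) p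
  embed : X → Σ (Fin n) (λ k → isInj₁ (f.to k) ≡ true)
  embed x = f.from (inj₁ x) , cong isInj₁ (f.strictlyInverseˡ (inj₁ x))
  back∘embed : ∀ x → back (embed x) ≡ x
  back∘embed x = inj₁-injective {B = Y} (trans (inj₁-fromInj₁ _ _) (f.strictlyInverseˡ (inj₁ x)))
  embed∘back : ∀ y → embed (back y) ≡ y
  embed∘back (k , p) = Σ-≡ (λ _ → Decidable⇒UIP.≡-irrelevant Bool._≟_) (trans (cong f.from (inj₁-fromInj₁ (f.to k) p)) (f.strictlyInverseʳ k))

-- `X` and `Y` are complementary decidable parts of `Fin n`, so each is counted by `countFin`. The
-- count for `Y` must be `c`, as bijective `Fin` types have equal size.
⊎-cancel : ∀ {X Y : Set} {n c} → Fin n ↔ (X ⊎ Y) → Fin c ↔ Y → ∃[ x ] (x + c ≡ n × (Fin x ↔ X))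
⊎-cancel {X} {Y} {n} {c} f c↔Y = countFin n (isInj₁ ∘ Inverse.to f) , trans (cong (λ y → countFin n (isInj₁ ∘ Inverse.to f) + y) c≡y) (complement n (Inverse.to f)) , summand↔ f
  where
  g : Fin n ↔ (Y ⊎ X)
  g = ↔-trans f (⊎-comm X Y)
  c≡y : c ≡ countFin n (isInj₁ ∘ Sum.swap ∘ Inverse.to f)
  c≡y = ↔⇒≡ (↔-trans c↔Y (↔-sym (summand↔ g)))
  complement : ∀ n (h : Fin n → X ⊎ Y) → countFin n (isInj₁ ∘ h) + countFin n (isInj₁ ∘ Sum.swap ∘ h) ≡ n
  complement zero    h = refl
  complement (suc n) h with h zero
  ... | inj₁ _ = cong suc (complement n (h ∘ suc))
  ... | inj₂ _ = trans (+-suc _ _) (cong suc (complement n (h ∘ suc)))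

-- The coefficients of F_d(0, 0) for d = n + 1, where the inner sum is a single binomial
-- coefficient.
innerSequence : ℕ → ℕ → ℕ
innerSequence n k = catalan (n ∸ k) * binom (n ∸ k) k

-- Pascal's rule in `motzkin-plain` gives F_d(1, 0) = F_d(0, 0) + z F_{d-1}(0, 0) for d = n + 2.
rootedCount≡ : ∀ n m → + rootedCount n m ≡ substitute (suc (suc n)) (innerSequence (suc n)) m ℤ.+ substitute (suc (suc n)) (shift (innerSequence n)) m
rootedCount≡ n m = trans (pathCount≡ _ _ (suc n) 1 m (suc (suc n)) ≤-refl)
  (trans (substitute-cong (suc (suc n)) (λ { k (s≤s k≤) → terms k k≤ }) m) (substitute-+ (suc (suc n)) (innerSequence (suc n)) (shift (innerSequence n)) m))
  where
  level : ∀ n → slopeList (λ _ → false) (λ _ → false) n ≡ replicate n 0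
  level zero    = refl
  level (suc n) = cong (0 ∷_) (level n)
  pascal : ∀ k → catalan (suc n ∸ k) * binom (suc (suc n ∸ k)) k ≡ innerSequence (suc n) k + shift (innerSequence n) k
  pascal zero    = sym (+-identityʳ _)
  pascal (suc k) = trans (*-distribˡ-+ (catalan (n ∸ k)) (binom (n ∸ k) k) _) (+-comm (catalan (n ∸ k) * binom (n ∸ k) k) _)
  terms : ∀ k → k ≤ suc n → motzkin (slopeList (λ _ → false) (λ _ → false) (suc n)) 1 k ≡ innerSequence (suc n) k + shift (innerSequence n) k
  terms k k≤ = trans (cong (λ δs → motzkin δs 1 k) (level (suc n))) (trans (motzkin-plain n k (suc n ∸ k) (m+[n∸m]≡n k≤)) (pascal k))

-- Let I_n, R and B be the weighted counts of forests by `innerLeaves` in size n, by `rootedLeaves`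
-- in size n + 1, and of branched forests. Then R = B + y I_n and I_{n+1} = B + I_n, so I_{n+1} = R
-- - z I_n, and `rootedCount≡` supplies R.
innerCount : ∀ n m → ∃[ N ] (+ N ≡ substitute (suc n) (innerSequence n) m × (Fin N ↔ Forests false n m))
innerCount zero zero = 1 , refl , mk↔ₛ′ (λ _ → [] , refl , refl) (λ _ → zero) (λ { ([] , refl , refl) → refl ; (node _ ∷ _ , () , _) }) (λ { zero → refl })
innerCount zero (suc m) = 0 , refl , empty↔ λ { ([] , _ , ()) ; (node _ ∷ _ , () , _) }
innerCount (suc n) m = x + a m , value , ↔-trans +↔⊎ (↔-trans (x↔ ⊎-↔ a↔ m) (forests-split false n m))
  where
  a : ℕ → ℕ
  a m = proj₁ (innerCount n m)
  a≡ : ∀ m → + a m ≡ substitute (suc n) (innerSequence n) m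
  a≡ m = proj₁ (proj₂ (innerCount n m))
  a↔ : ∀ m → Fin (a m) ↔ Forests false n m
  a↔ m = proj₂ (proj₂ (innerCount n m))
  branched : ∃[ x ] (x + shift a m ≡ rootedCount n m × (Fin x ↔ Branched n m))
  branched = ⊎-cancel (↔-trans (rooted↔ n m) (↔-sym (forests-split true n m))) (weigh↔ innerLeaves a (λ _ → ≡-irrelevant) a↔ true m)
  x = proj₁ branched
  x↔ = proj₂ (proj₂ branched)
  A A′ S : ℤ
  A  = substitute (suc n) (innerSequence n) m
  A′ = substitute (suc (suc n)) (innerSequence (suc n)) m
  S  = substitute (suc (suc n)) (shift (innerSequence n)) m
  shifted : ∀ m → + shift a m ≡ shiftℤ (substitute (suc n) (innerSequence n)) m
  shifted zero    = refl
  shifted (suc m) = a≡ m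
  x≡ : + x ℤ.+ (S ℤ.+ A) ≡ A′ ℤ.+ S
  x≡ = trans (cong (λ y → + x ℤ.+ y) (sym (trans (shifted m) (substitute-shift (suc n) (innerSequence n) m))))
    (trans (cong +_ (proj₁ (proj₂ branched))) (rootedCount≡ n m))
  value : + x ℤ.+ + a m ≡ A′
  value = trans (cong (λ y → + x ℤ.+ y) (a≡ m)) (trans (isolate (+ x) S A) (trans (cong (ℤ._- S) x≡) (drop A′ S)))
    where
    isolate : ∀ x s a → x ℤ.+ a ≡ x ℤ.+ (s ℤ.+ a) ℤ.- s
    isolate = ℤ-Solver.solve-∀
    drop : ∀ a s → a ℤ.+ s ℤ.- s ≡ a
    drop = ℤ-Solver.solve-∀

theorem-zero : ∀ n m → m ≤ suc n →
  ∃[ N ] ((coeff (fPoly (suc n) 0 0) (suc n ∸ m) ≡ + N)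
    × (Fin N ↔ Σ Tree (λ t → size t ≡ suc n × countSpecial 0 0 t ≡ m)))
theorem-zero n m m≤d with innerCount n m
... | N , N≡ , N↔ = N ,
  trans (coeff-fPoly (suc n) 0 0 m m≤d) (trans (substitute-cong (suc n) sequence m) (sym N≡)) ,
  ↔-trans N↔ (tree↔ n innerLeaves (countSpecial 0 0) m λ { ts refl →
    trans (sym (count-leaves (counted₀₀-leaves (sizes ts)) true true 0 ts ≤-refl)) (countSpecial≡ 0 0 ts (suc (sizes ts)) refl) })
  where
  sequence : ∀ k → k < suc n → fSequence (suc n) 0 0 k ≡ innerSequence n k
  sequence k k<d = cong (catalan (n ∸ k) *_) (trans (innerSum≡ (suc n) 0 0 k k<d)
    (cong (λ N → binom (N ∸ k) k) (trans (+-identityʳ (n + 0)) (+-identityʳ n))))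

theorem3p12 : (d i j : ℕ) → 2 ≤ d → j < d ∸ 1 →
    ((i ≡ 0 × j ≡ 0) ⊎ (1 ≤ i × i + j ≤ d ∸ 1)) →
    (m : ℕ) → m ≤ d →
    ∃[ N ] ((coeff (fPoly d i j) (d ∸ m) ≡ + N)
    × (Fin N ↔ Σ Tree (λ t → size t ≡ d × countSpecial i j t ≡ m)))
theorem3p12 (suc n) .0 .0 _ _ (inj₁ (refl , refl)) m m≤d = theorem-zero n m m≤d
theorem3p12 (suc n) (suc c) a _ _ (inj₂ (_ , i+j≤n)) m m≤d with m≤n⇒∃[o]m+o≡n i+j≤n
-- `b` is the number d - 1 - i - j of labels strictly between i and d - j.
... | b , refl = subst (λ n → m ≤ suc n → ∃[ N ] ((coeff (fPoly (suc n) (suc c) a) (suc n ∸ m) ≡ + N)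
    × (Fin N ↔ Σ Tree (λ t → size t ≡ suc n × countSpecial (suc c) a t ≡ m)))) (reorder a b (suc c)) (theorem-positive a b c m) m≤d
  where
  reorder : ∀ a b c → a + (b + c) ≡ c + a + b
  reorder = ℕ-Solver.solve-∀
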